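{- There exists a strong completion $\mathcal{A}$ of $\mathcal{K}_1$ of low Turing degree; that is, there exist a low set $Y\subseteq\omega$ and a strong completion $\mathcal{A}$ of $\mathcal{K}_1$ such that $\mathcal{A}$ is $Y$-computable.
   Context: A set $Y\subseteq\omega$ is low if $Y'\leq_T\emptyset'$, where $'$ denotes the Turing jump. A partial applicative structure (pas) is a set $\mathcal{A}$ with a partial binary operation $(a,b)\mapsto a\cdot b=ab$, called application, associating to the left; $ab\downarrow$ means that $ab$ is defined. Application is strict: a compound term $t_1t_2$ is defined only if $t_1$ and $t_2$ are both defined. For closed terms, $t\simeq s$ means that either both are undefined, or both are defined and equal. Elements $k,s\in\mathcal{A}$ serve as combinators for $\mathcal{A}$ if for all $a,b,c\in\mathcal{A}$: $ka\downarrow$ and $kab=a$; $sab\downarrow$ and $sabc\simeq ac(bc)$. A pas is a partial combinatory algebra (pca) if it has such combinators $k,s$. A combinatory algebra is a pca whose application is total. All pcas are assumed nontrivial, i.e. to have more than one element. $\mathcal{K}_1$ (Kleene's first model) is the pca on $\omega$ with application $n\cdot m=\varphi_n(m)$, where $\varphi_n$ is the $n$-th partial computable function. A weak embedding of a pca $\mathcal{A}$ into a pca $\mathcal{B}$ is an injection $f:\mathcal{A}\to\mathcal{B}$ such that for all $a,b\in\mathcal{A}$, if $ab$ is defined in $\mathcal{A}$, then $f(a)f(b)$ is defined in $\mathcal{B}$ and equals $f(ab)$. It is a strong embedding if in addition, for a specific choice of combinators $k,s$ of $\mathcal{A}$, the elements $f(k),f(s)$ serve as combinators for $\mathcal{B}$.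 A strong completion of $\mathcal{A}$ is a (total) combinatory algebra $\mathcal{B}$ for which there is a strong embedding of $\mathcal{A}$ into $\mathcal{B}$. A combinatory algebra $\mathcal{A}$ is $Y$-computable if there are a surjection (numbering) $\gamma:\omega\to\mathcal{A}$ and a total $Y$-computable function $\psi:\omega^2\to\omega$ such that $\gamma(n)\cdot\gamma(m)=\gamma(\psi(n,m))$ for all $n,m$, and such that the set $\{(n,m)\mid\gamma(n)=\gamma(m)\}$ is $Y$-computable. (No effectivity is required of $\gamma$ itself.) -}

module Defs where

open import Level using (0ℓ)
open import Data.Empty using (⊥-elim)
open import Data.Nat.Base
open import Data.Nat.Properties
open import Data.Product using (_×_; _,_; ∃-syntax; Σ-syntax; proj₁; proj₂)
open import Data.Sum.Base using (_⊎_; inj₁; inj₂)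
open import Function.Definitions using (Injective; StrictlySurjective)
open import Relation.Binary.Definitions using (tri<; tri≈; tri>)
open import Relation.Binary.PropositionalEquality
open import Relation.Nullary using (¬_)
open import Relation.Unary using (Pred; _∈_; _∉_; ∅)

------------------------------------------------------------------------
-- Cantor pairing

triangle : ℕ → ℕ
triangle zero    = 0
triangle (suc n) = suc n + triangle n

⟨_,_⟩ : ℕ → ℕ → ℕ
⟨ a , b ⟩ = triangle (a + b) + b

-- The successor of a point in the enumeration of ℕ × ℕ along the
-- diagonals (0,0), (1,0), (0,1), (2,0), (1,1), (0,2), …
next : ℕ × ℕ → ℕ × ℕ
next (zero  , b) = suc b , 0
next (suc a , b) = a , suc b

unpair : ℕ → ℕ × ℕ
unpair zero    = 0 , 0
unpair (suc n) = next (unpair n)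

π₁ π₂ : ℕ → ℕ
π₁ n = proj₁ (unpair n)
π₂ n = proj₂ (unpair n)

private
  pair-next : ∀ p → ⟨ proj₁ (next p) , proj₂ (next p) ⟩ ≡ suc ⟨ proj₁ p , proj₂ p ⟩
  pair-next (zero , b) = begin
    triangle (suc b + 0) + 0     ≡⟨ +-identityʳ _ ⟩
    triangle (suc b + 0)         ≡⟨ cong triangle (+-identityʳ (suc b)) ⟩
    suc (b + triangle b)         ≡⟨ cong suc (+-comm b (triangle b)) ⟩
    suc (triangle b + b)         ∎
    where open ≡-Reasoning
  pair-next (suc a , b) = begin
    triangle (a + suc b) + suc b     ≡⟨ +-suc _ b ⟩
    suc (triangle (a + suc b) + b)   ≡⟨ cong (λ s → suc (triangle s + b)) (+-suc a b) ⟩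
    suc (triangle (suc a + b) + b)   ∎
    where open ≡-Reasoning

pair-unpair : ∀ n → ⟨ π₁ n , π₂ n ⟩ ≡ n
pair-unpair zero    = refl
pair-unpair (suc n) = trans (pair-next (unpair n)) (cong suc (pair-unpair n))

private
  diagonal : ∀ s → unpair ⟨ s , 0 ⟩ ≡ (s , 0) →
             ∀ b a → a + b ≡ s → unpair ⟨ a , b ⟩ ≡ (a , b)
  diagonal s h zero    a e =
    subst (λ x → unpair ⟨ x , 0 ⟩ ≡ (x , 0)) (trans (sym e) (+-identityʳ a)) h
  diagonal s h (suc b) a e =
    trans (cong unpair (pair-next (suc a , b)))
          (cong next (diagonal s h b (suc a) (trans (sym (+-suc a b)) e)))

  diagonal-start : ∀ s → unpair ⟨ s , 0 ⟩ ≡ (s , 0)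
  diagonal-start zero    = refl
  diagonal-start (suc s) =
    trans (cong unpair (pair-next (0 , s)))
          (cong next (diagonal s (diagonal-start s) s 0 refl))

unpair-pair : ∀ a b → unpair ⟨ a , b ⟩ ≡ (a , b)
unpair-pair a b = diagonal (a + b) (diagonal-start (a + b)) b a refl

------------------------------------------------------------------------
-- Oracle computability

-- Programs for the unary partial functions computable in an oracle.
-- Several arguments are passed as one through the Cantor pairing.
data Code : Set where
  Zero Succ Fst Snd Oracle : Code
  Pair Comp Prec           : Code → Code → Code
  Mu                       : Code → Code

-- Partial functions are given by their graphs.
PrimRec : (ℕ → ℕ → Set) → (ℕ → ℕ → Set) → ℕ → ℕ → ℕ → Set
PrimRec F G x zero    y = F x y
PrimRec F G x (suc n) y = ∃[ r ] (PrimRec F G x n r × G ⟨ x , ⟨ n , r ⟩ ⟩ y)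

-- ⟦ c ⟧ Y x y : program c with oracle Y halts on input x with output y.
-- The oracle instruction computes the characteristic function of Y.
⟦_⟧ : Code → Pred ℕ 0ℓ → ℕ → ℕ → Set
⟦ Zero ⟧     Y x y = y ≡ 0
⟦ Succ ⟧     Y x y = y ≡ suc x
⟦ Fst ⟧      Y x y = y ≡ π₁ x
⟦ Snd ⟧      Y x y = y ≡ π₂ x
⟦ Oracle ⟧   Y x y = (x ∈ Y × y ≡ 1) ⊎ (x ∉ Y × y ≡ 0)
⟦ Pair c d ⟧ Y x y = ∃[ a ] ∃[ b ] (⟦ c ⟧ Y x a × ⟦ d ⟧ Y x b × y ≡ ⟨ a , b ⟩)
⟦ Comp c d ⟧ Y x y = ∃[ a ] (⟦ d ⟧ Y x a × ⟦ c ⟧ Y a y)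
⟦ Prec c d ⟧ Y x y = PrimRec (⟦ c ⟧ Y) (⟦ d ⟧ Y) (π₁ x) (π₂ x) y
⟦ Mu c ⟧     Y x y = ⟦ c ⟧ Y ⟨ x , y ⟩ 0
                   × (∀ j → j < y → ∃[ v ] ⟦ c ⟧ Y ⟨ x , j ⟩ (suc v))

-- A number ⟨ t , p ⟩ is read as the program with outermost instruction t
-- and immediate subprograms given by p.  The first argument of decodeWithin
-- bounds the recursion depth; decode supplies enough of it, since payloads of
-- compound programs are smaller than the program's number.
build : (ℕ → Code) → ℕ → ℕ → Code
build dec 0 p = Zero
build dec 1 p = Succ
build dec 2 p = Fst
build dec 3 p = Snd
build dec 4 p = Oracle
build dec 5 p = Pair (dec (π₁ p)) (dec (π₂ p))
build dec 6 p = Comp (dec (π₁ p)) (dec (π₂ p))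
build dec 7 p = Prec (dec (π₁ p)) (dec (π₂ p))
build dec _ p = Mu (dec p)

decodeWithin : ℕ → ℕ → Code
decodeWithin zero    n = Zero
decodeWithin (suc k) n = build (decodeWithin k) (π₁ n) (π₂ n)

decode : ℕ → Code
decode n = decodeWithin (suc n) n

encode : Code → ℕ
encode Zero       = ⟨ 0 , 0 ⟩
encode Succ       = ⟨ 1 , 0 ⟩
encode Fst        = ⟨ 2 , 0 ⟩
encode Snd        = ⟨ 3 , 0 ⟩
encode Oracle     = ⟨ 4 , 0 ⟩
encode (Pair c d) = ⟨ 5 , ⟨ encode c , encode d ⟩ ⟩
encode (Comp c d) = ⟨ 6 , ⟨ encode c , encode d ⟩ ⟩
encode (Prec c d) = ⟨ 7 , ⟨ encode c , encode d ⟩ ⟩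
encode (Mu c)     = ⟨ 8 , encode c ⟩

private
  n≤triangle : ∀ n → n ≤ triangle n
  n≤triangle zero    = z≤n
  n≤triangle (suc n) = m≤m+n (suc n) (triangle n)

  left≤ : ∀ a b → a ≤ ⟨ a , b ⟩
  left≤ a b = ≤-trans (m≤m+n a b) (≤-trans (n≤triangle (a + b)) (m≤m+n _ b))

  right≤ : ∀ a b → b ≤ ⟨ a , b ⟩
  right≤ a b = m≤n+m b (triangle (a + b))

  right< : ∀ t p → p < ⟨ suc t , p ⟩
  right< t p = s≤s (m≤n+m p (t + p + triangle (t + p)))

  module _ {k : ℕ} where
    payload< : ∀ t p → ⟨ suc t , p ⟩ < suc k → p < k
    payload< t p (s≤s h) = <-≤-trans (right< t p) h

    first< : ∀ t a b → ⟨ suc t , ⟨ a , b ⟩ ⟩ < suc k → a < k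
    first< t a b h = ≤-<-trans (left≤ a b) (payload< t ⟨ a , b ⟩ h)

    second< : ∀ t a b → ⟨ suc t , ⟨ a , b ⟩ ⟩ < suc k → b < k
    second< t a b h = ≤-<-trans (right≤ a b) (payload< t ⟨ a , b ⟩ h)

  decodeWithin-encode : ∀ k c → encode c < k → decodeWithin k (encode c) ≡ c
  decodeWithin-encode (suc k) Zero       h = refl
  decodeWithin-encode (suc k) Succ       h = refl
  decodeWithin-encode (suc k) Fst        h = refl
  decodeWithin-encode (suc k) Snd        h = refl
  decodeWithin-encode (suc k) Oracle     h = refl
  decodeWithin-encode (suc k) (Pair c d) h
    rewrite unpair-pair 5 ⟨ encode c , encode d ⟩ | unpair-pair (encode c) (encode d)
    = cong₂ Pair
            (decodeWithin-encode k c (first< 4 (encode c) (encode d) h))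
            (decodeWithin-encode k d (second< 4 (encode c) (encode d) h))
  decodeWithin-encode (suc k) (Comp c d) h
    rewrite unpair-pair 6 ⟨ encode c , encode d ⟩ | unpair-pair (encode c) (encode d)
    = cong₂ Comp
            (decodeWithin-encode k c (first< 5 (encode c) (encode d) h))
            (decodeWithin-encode k d (second< 5 (encode c) (encode d) h))
  decodeWithin-encode (suc k) (Prec c d) h
    rewrite unpair-pair 7 ⟨ encode c , encode d ⟩ | unpair-pair (encode c) (encode d)
    = cong₂ Prec
            (decodeWithin-encode k c (first< 6 (encode c) (encode d) h))
            (decodeWithin-encode k d (second< 6 (encode c) (encode d) h))
  decodeWithin-encode (suc k) (Mu c)     h
    rewrite unpair-pair 8 (encode c)
    = cong Mu (decodeWithin-encode k c (payload< 7 (encode c) h))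

decode-encode : ∀ c → decode (encode c) ≡ c
decode-encode c = decodeWithin-encode (suc (encode c)) c ≤-refl

-- Φ Y n x y : the n-th partial Y-computable function maps x to y.
Φ : Pred ℕ 0ℓ → ℕ → ℕ → ℕ → Set
Φ Y n = ⟦ decode n ⟧ Y

φ : ℕ → ℕ → ℕ → Set
φ = Φ ∅

infix 25 _′
_′ : Pred ℕ 0ℓ → Pred ℕ 0ℓ
(Y ′) n = ∃[ y ] Φ Y n n y

infix 4 _≤T_
_≤T_ : Pred ℕ 0ℓ → Pred ℕ 0ℓ → Set
X ≤T Y = ∃[ e ] (∀ n → (n ∈ X → Φ Y e n 1) × (n ∉ X → Φ Y e n 0))

Low : Pred ℕ 0ℓ → Set
Low Y = Y ′ ≤T ∅ ′

ComputableIn₂ : Pred ℕ 0ℓ → (ℕ → ℕ → ℕ) → Set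
ComputableIn₂ Y ψ = ∃[ e ] (∀ n m → Φ Y e ⟨ n , m ⟩ (ψ n m))

------------------------------------------------------------------------
-- Partial applicative structures

-- a · b ↦ c : the application a b is defined and equal to c.
record PAS : Set₁ where
  field
    Carrier    : Set
    _·_↦_      : Carrier → Carrier → Carrier → Set
    functional : ∀ {a b c d} → a · b ↦ c → a · b ↦ d → c ≡ d

  infixl 6 _∙_
  data Term : Set where
    con : Carrier → Term
    _∙_ : Term → Term → Term

  infix 4 _⇓_ _↓ _≃_
  _⇓_ : Term → Carrier → Set
  con a   ⇓ c = a ≡ c
  (t ∙ u) ⇓ c = ∃[ a ] ∃[ b ] (t ⇓ a × u ⇓ b × a · b ↦ c)

  _↓ : Term → Set
  t ↓ = ∃[ c ] t ⇓ c

  _≃_ : Term → Term → Set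
  t ≃ u = (¬ (t ↓) × ¬ (u ↓)) ⊎ (∃[ c ] (t ⇓ c × u ⇓ c))

  record IsCombinators (k s : Carrier) : Set where
    field
      ka↓  : ∀ a → con k ∙ con a ↓
      kab  : ∀ a b → con k ∙ con a ∙ con b ⇓ a
      sab↓ : ∀ a b → con s ∙ con a ∙ con b ↓
      sabc : ∀ a b c →
             con s ∙ con a ∙ con b ∙ con c ≃ con a ∙ con c ∙ (con b ∙ con c)

  Nontrivial : Set
  Nontrivial = Σ[ a ∈ Carrier ] ∃[ b ] a ≢ b

  Total : Set
  Total = ∀ a b → ∃[ c ] (a · b ↦ c)

  IsPCA : Set
  IsPCA = Nontrivial × (∃[ k ] ∃[ s ] IsCombinators k s)

  IsCombinatoryAlgebra : Set
  IsCombinatoryAlgebra = IsPCA × Total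

open PAS using (Carrier; IsCombinators; IsCombinatoryAlgebra)

record WeakEmbedding (𝒜 ℬ : PAS) : Set where
  private
    module A = PAS 𝒜
    module B = PAS ℬ
  field
    f         : A.Carrier → B.Carrier
    injective : Injective _≡_ _≡_ f
    preserves : ∀ {a b c} → a A.· b ↦ c → f a B.· f b ↦ f c

record StrongEmbedding (𝒜 ℬ : PAS) : Set where
  field
    weakEmbedding : WeakEmbedding 𝒜 ℬ
  open WeakEmbedding weakEmbedding public
  field
    k s             : Carrier 𝒜
    ks-combinators  : IsCombinators 𝒜 k s
    fks-combinators : IsCombinators ℬ (f k) (f s)

IsStrongCompletion : PAS → PAS → Set
IsStrongCompletion 𝒜 ℬ = IsCombinatoryAlgebra ℬ × StrongEmbedding 𝒜 ℬ

record _-Computable (Y : Pred ℕ 0ℓ) (𝒜 : PAS) : Set where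
  open PAS 𝒜 using (_·_↦_)
  field
    γ            : ℕ → Carrier 𝒜
    γ-surjective : StrictlySurjective _≡_ γ
    ψ            : ℕ → ℕ → ℕ
    ψ-computable : ComputableIn₂ Y ψ
    γ-ψ          : ∀ n m → γ n · γ m ↦ γ (ψ n m)
    ≡-computable : (λ p → γ (π₁ p) ≡ γ (π₂ p)) ≤T Y

------------------------------------------------------------------------
-- Kleene's first model

PrimRec-functional : ∀ {F G} →
  (∀ x {y z} → F x y → F x z → y ≡ z) →
  (∀ x {y z} → G x y → G x z → y ≡ z) →
  ∀ x n {y z} → PrimRec F G x n y → PrimRec F G x n z → y ≡ z
PrimRec-functional hF hG x zero    p q = hF x p q
PrimRec-functional hF hG x (suc n) (r , p , p′) (r′ , q , q′)
  with refl ← PrimRec-functional hF hG x n p q = hG _ p′ q′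

⟦⟧-functional : ∀ c Y x {y z} → ⟦ c ⟧ Y x y → ⟦ c ⟧ Y x z → y ≡ z
⟦⟧-functional Zero   Y x p q = trans p (sym q)
⟦⟧-functional Succ   Y x p q = trans p (sym q)
⟦⟧-functional Fst    Y x p q = trans p (sym q)
⟦⟧-functional Snd    Y x p q = trans p (sym q)
⟦⟧-functional Oracle Y x (inj₁ (_ , p)) (inj₁ (_ , q)) = trans p (sym q)
⟦⟧-functional Oracle Y x (inj₁ (i , _)) (inj₂ (o , _)) = ⊥-elim (o i)
⟦⟧-functional Oracle Y x (inj₂ (o , _)) (inj₁ (i , _)) = ⊥-elim (o i)
⟦⟧-functional Oracle Y x (inj₂ (_ , p)) (inj₂ (_ , q)) = trans p (sym q)
⟦⟧-functional (Pair c d) Y x (_ , _ , p , p′ , refl) (_ , _ , q , q′ , refl) =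
  cong₂ ⟨_,_⟩ (⟦⟧-functional c Y x p q) (⟦⟧-functional d Y x p′ q′)
⟦⟧-functional (Comp c d) Y x (a , p , p′) (b , q , q′)
  with refl ← ⟦⟧-functional d Y x p q = ⟦⟧-functional c Y a p′ q′
⟦⟧-functional (Prec c d) Y x p q =
  PrimRec-functional (⟦⟧-functional c Y) (⟦⟧-functional d Y) (π₁ x) (π₂ x) p q
⟦⟧-functional (Mu c) Y x {y} {z} (p , p′) (q , q′) with <-cmp y z
... | tri≈ _ y≡z _ = y≡z
... | tri< y<z _ _ with () ← ⟦⟧-functional c Y _ p (proj₂ (q′ y y<z))
... | tri> _ _ z<y with () ← ⟦⟧-functional c Y _ q (proj₂ (p′ z z<y))

K₁ : PAS
K₁ = record
  { Carrier    = ℕ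
  ; _·_↦_      = φ
  ; functional = λ {n} {m} → ⟦⟧-functional (decode n) ∅ m
  }

{-# OPTIONS --safe #-}
module Submission where

-- The congruences on applicative terms over K₁ that contain the graph of φ and
-- the laws of k and s and separate the elements of K₁ form a Π⁰₁ class.  If it is
-- nonempty, the low basis theorem gives a low member Y, and the term model modulo
-- Y is the desired completion.  In terms of the jump, being in the class means
-- that a fixed oracle program, searching for a violated axiom, diverges; so the
-- low basis theorem is only needed in the form: if v ∉ X′ for some X, then
-- v ∉ Y′ for some low Y.
--
-- A member of the class comes from a graph model in the style of Engeler, whose
-- elements are the sets of atoms n and arrows F ⇒ x with F finite.  An element n
-- of K₁ denotes the least set containing the atom n and such that the
-- application to the denotation of m is the denotation of n · m.  The
-- combinators k, s and their partial applications k a, s a, s a b are given more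
-- arrows, so that their laws hold in the whole model.  That s a b still extends
-- the application of K₁ is proved by induction on computations, because s a b c
-- runs a c (b c) in a simulation.

open import Level using (0ℓ)
open import Axiom.ExcludedMiddle using (ExcludedMiddle)
open import Data.Bool.Base using (Bool; true; false)
open import Data.Empty using (⊥-elim)
open import Data.Fin.Base using (Fin; zero; suc)
open import Data.List.Base using (List; []; _∷_; _++_; [_])
open import Data.List.Membership.Propositional using () renaming (_∈_ to _∈ˡ_)
open import Data.List.Membership.Propositional.Properties using (∈-++⁺ˡ; ∈-++⁺ʳ)
open import Data.List.Relation.Unary.All as All using (All; []; _∷_)
open import Data.List.Relation.Unary.All.Properties using (++⁺)
open import Data.List.Relation.Unary.Any using (here; there)
open import Data.Maybe.Base using (Maybe; just; nothing)
open import Data.Nat.Base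
open import Data.Nat.Induction using (<-rec; <-wellFounded; Acc; acc)
open import Data.Nat.Properties
open import Data.Product using (_×_; _,_; ∃-syntax; Σ-syntax; proj₁; proj₂)
open import Data.Sum.Base using (_⊎_; inj₁; inj₂; map₂)
open import Data.Unit.Base using (⊤; tt)
open import Data.Vec.Base using (Vec; lookup; tabulate) renaming ([] to []ᵛ; _∷_ to _∷ᵛ_)
open import Relation.Binary.Definitions using (tri<; tri≈; tri>)
open import Relation.Binary.PropositionalEquality hiding ([_])
open import Relation.Nullary using (¬_; yes; no)
open import Relation.Unary using (Pred; ∅; _∈_; _∉_; _⊆_; _≐_)
open import Relation.Unary.Properties using (≐-refl; ≐-sym; ≐-trans)
open import Defs

-- The obstacle is that the laws of `k` and `s` must hold for all elements of the completion, while
-- in K₁ the values of `k a`, `s a` and `s a b` are already particular indices. Denoting these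
-- indices by their graphs under φ would control them only on arguments from K₁. The combinators are
-- therefore chosen so that each such index carries a label from which its kind and its arguments
-- can be recovered. The denotation is then prescribed by kind, and its agreement with φ becomes
-- something to prove. For `s a b` this needs a measure that decreases when the intermediate result,
-- an arbitrary index, is simulated: the simulation finds its halting time by a `Mu`, and `Within`
-- bounds all results of `Mu`. The class is Π⁰₁ because the rule for φ can be quantified over
-- numbers of steps and distinct numbers can be listed as `a` and `b + suc a`. A member `Y` is
-- itself the equality relation on terms, and application of terms is pairing, so `Y`-computability
-- of the term model costs nothing further.

-- Primitive recursive programs

-- The pairing is sealed so that conversion checking never unfolds it.
opaque
  pair : ℕ → ℕ → ℕ
  pair a b = ⟨ a , b ⟩

  pair-def : ∀ a b → pair a b ≡ ⟨ a , b ⟩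
  pair-def a b = refl

π₁-⟨⟩ : ∀ a b → π₁ ⟨ a , b ⟩ ≡ a
π₁-⟨⟩ a b = cong proj₁ (unpair-pair a b)

π₂-⟨⟩ : ∀ a b → π₂ ⟨ a , b ⟩ ≡ b
π₂-⟨⟩ a b = cong proj₂ (unpair-pair a b)

π₁-pair : ∀ a b → π₁ (pair a b) ≡ a
π₁-pair a b = trans (cong π₁ (pair-def a b)) (π₁-⟨⟩ a b)

π₂-pair : ∀ a b → π₂ (pair a b) ≡ b
π₂-pair a b = trans (cong π₂ (pair-def a b)) (π₂-⟨⟩ a b)

pair-π : ∀ n → pair (π₁ n) (π₂ n) ≡ n
pair-π n = trans (pair-def _ _) (pair-unpair n)

pair-injective : ∀ {a b c d} → pair a b ≡ pair c d → a ≡ c × b ≡ d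
pair-injective {a} {b} {c} {d} e =
  trans (sym (π₁-pair a b)) (trans (cong π₁ e) (π₁-pair c d)) ,
  trans (sym (π₂-pair a b)) (trans (cong π₂ e) (π₂-pair c d))

-- Numbers, remembering how they were built by pairing: projections of a node
-- then compute definitionally.
data Val : Set where
  leaf : ℕ → Val
  node : Val → Val → Val

num : Val → ℕ
num (leaf n)   = n
num (node u v) = pair (num u) (num v)

fstV sndV : Val → Val
fstV (leaf n)   = leaf (π₁ n)
fstV (node u v) = u
sndV (leaf n)   = leaf (π₂ n)
sndV (node u v) = v

num-fstV : ∀ v → num (fstV v) ≡ π₁ (num v)
num-fstV (leaf n)   = refl
num-fstV (node u v) = sym (π₁-pair (num u) (num v))

num-sndV : ∀ v → num (sndV v) ≡ π₂ (num v)
num-sndV (leaf n)   = refl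
num-sndV (node u v) = sym (π₂-pair (num u) (num v))

infixr 5 _,ᵗ_
-- Terms are evaluated in `Val` so that most correctness proofs about the programs below reduce to
-- `refl`. `flat` forgets how a number was built, for components that the machine stores as plain
-- numbers. `call` evaluates a body in a fresh environment and so takes the place of syntactic
-- weakening and substitution.
data Tm (n : ℕ) : Set where
  var       : Fin n → Tm n
  lit       : ℕ → Tm n
  sucᵗ      : Tm n → Tm n
  _,ᵗ_      : Tm n → Tm n → Tm n
  fstᵗ sndᵗ : Tm n → Tm n
  flat      : Tm n → Tm n
  ask       : Tm n → Tm n
  rec       : Tm n → Tm n → Tm (2 + n) → Tm n
  call      : ∀ {m} → Tm m → Vec (Tm n) m → Tm n

natrec : ∀ {a} {A : Set a} → A → (ℕ → A → A) → ℕ → A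
natrec z s zero    = z
natrec z s (suc n) = s n (natrec z s n)

module _ (χ : ℕ → ℕ) where
  eval  : ∀ {n} → Tm n → Vec Val n → Val
  evals : ∀ {n m} → Vec (Tm n) m → Vec Val n → Vec Val m
  eval (var i)     ρ = lookup ρ i
  eval (lit n)     ρ = leaf n
  eval (sucᵗ t)    ρ = leaf (suc (num (eval t ρ)))
  eval (t ,ᵗ u)    ρ = node (eval t ρ) (eval u ρ)
  eval (fstᵗ t)    ρ = fstV (eval t ρ)
  eval (sndᵗ t)    ρ = sndV (eval t ρ)
  eval (flat t)    ρ = leaf (num (eval t ρ))
  eval (ask t)     ρ = leaf (χ (num (eval t ρ)))
  eval (rec t b s) ρ =
    natrec (eval b ρ) (λ i r → eval s (leaf i ∷ᵛ r ∷ᵛ ρ)) (num (eval t ρ))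
  eval (call t ts) ρ = eval t (evals ts ρ)
  evals []ᵛ       ρ = []ᵛ
  evals (t ∷ᵛ ts) ρ = eval t ρ ∷ᵛ evals ts ρ

-- The predecessor is variable 0 of the second branch; variable 1 is junk.
case : ∀ {n} → Tm n → Tm n → Tm (2 + n) → Tm n
case = rec

v0 : ∀ {n} → Tm (1 + n)
v0 = var zero
v1 : ∀ {n} → Tm (2 + n)
v1 = var (suc zero)
v2 : ∀ {n} → Tm (3 + n)
v2 = var (suc (suc zero))
v3 : ∀ {n} → Tm (4 + n)
v3 = var (suc (suc (suc zero)))
v4 : ∀ {n} → Tm (5 + n)
v4 = var (suc (suc (suc (suc zero))))
v5 : ∀ {n} → Tm (6 + n)
v5 = var (suc (suc (suc (suc (suc zero)))))

constC : ℕ → Code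
constC zero    = Zero
constC (suc n) = Comp Succ (constC n)

Id : Code
Id = Pair Fst Snd

compileVar : ∀ {n} → Fin n → Code
compileVar zero    = Fst
compileVar (suc i) = Comp (compileVar i) Snd

compile  : ∀ {n} → Tm n → Code
compiles : ∀ {n m} → Vec (Tm n) m → Code
compile (var i)     = compileVar i
compile (lit n)     = constC n
compile (sucᵗ t)    = Comp Succ (compile t)
compile (t ,ᵗ u)    = Pair (compile t) (compile u)
compile (fstᵗ t)    = Comp Fst (compile t)
compile (sndᵗ t)    = Comp Snd (compile t)
compile (flat t)    = compile t
compile (ask t)     = Comp Oracle (compile t)
-- `Prec` passes ⟨ ρ , ⟨ i , r ⟩ ⟩ to its step, whereas `s` expects the environment i, r, ρ; the
-- nested pairs rearrange one into the other.
compile (rec t b s) =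
  Comp (Prec (compile b)
             (Comp (compile s) (Pair (Comp Fst Snd) (Pair (Comp Snd Snd) Fst))))
       (Pair Id (compile t))
compile (call t ts) = Comp (compile t) (compiles ts)
compiles []ᵛ       = Zero
compiles (t ∷ᵛ ts) = Pair (compile t) (compiles ts)

env : ∀ {n} → Vec Val n → ℕ
env []ᵛ      = 0
env (v ∷ᵛ ρ) = pair (num v) (env ρ)

Char : Pred ℕ 0ℓ → (ℕ → ℕ) → Set
Char Y χ = ∀ i → ⟦ Oracle ⟧ Y i (χ i)

constC-correct : ∀ Y n x → ⟦ constC n ⟧ Y x n
constC-correct Y zero    x = refl
constC-correct Y (suc n) x = n , constC-correct Y n x , refl

Id-correct : ∀ Y x → ⟦ Id ⟧ Y x x
Id-correct Y x = _ , _ , refl , refl , sym (pair-unpair x)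

Pair-correct : ∀ Y c d x {a b} → ⟦ c ⟧ Y x a → ⟦ d ⟧ Y x b →
               ⟦ Pair c d ⟧ Y x (pair a b)
Pair-correct Y c d x p q = _ , _ , p , q , pair-def _ _

module _ {Y : Pred ℕ 0ℓ} {χ : ℕ → ℕ} (Yχ : Char Y χ) where
  compile-correct  : ∀ {n} (t : Tm n) ρ →
                     ⟦ compile t ⟧ Y (env ρ) (num (eval χ t ρ))
  compiles-correct : ∀ {n m} (ts : Vec (Tm n) m) ρ →
                     ⟦ compiles ts ⟧ Y (env ρ) (env (evals χ ts ρ))

  compileVar-correct : ∀ {n} (i : Fin n) ρ →
                       ⟦ compileVar i ⟧ Y (env ρ) (num (lookup ρ i))
  compileVar-correct zero    (v ∷ᵛ ρ) = sym (π₁-pair (num v) (env ρ))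
  compileVar-correct (suc i) (v ∷ᵛ ρ) =
    _ , sym (π₂-pair (num v) (env ρ)) , compileVar-correct i ρ

  compile-correct (var i)  ρ = compileVar-correct i ρ
  compile-correct (lit n)  ρ = constC-correct Y n (env ρ)
  compile-correct (sucᵗ t) ρ = _ , compile-correct t ρ , refl
  compile-correct (t ,ᵗ u) ρ =
    Pair-correct Y (compile t) (compile u) (env ρ) (compile-correct t ρ) (compile-correct u ρ)
  compile-correct (fstᵗ t) ρ = _ , compile-correct t ρ , num-fstV (eval χ t ρ)
  compile-correct (sndᵗ t) ρ = _ , compile-correct t ρ , num-sndV (eval χ t ρ)
  compile-correct (flat t) ρ = compile-correct t ρ
  compile-correct (ask t)  ρ = _ , compile-correct t ρ , Yχ _
  compile-correct (rec t b s) ρ =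
    _ , Pair-correct Y Id (compile t) (env ρ) (Id-correct Y (env ρ)) (compile-correct t ρ) ,
    subst₂ (λ x m → PrimRec F G x m (value n)) (sym (π₁-pair (env ρ) n)) (sym (π₂-pair (env ρ) n))
           (iterate n)
    where
    n = num (eval χ t ρ)
    shuffle = Pair (Comp Fst Snd) (Pair (Comp Snd Snd) Fst)
    F = ⟦ compile b ⟧ Y
    G = ⟦ Comp (compile s) shuffle ⟧ Y
    valueV : ℕ → Val
    valueV = natrec (eval χ b ρ) (λ i r → eval χ s (leaf i ∷ᵛ r ∷ᵛ ρ))
    value : ℕ → ℕ
    value i = num (valueV i)
    iterate : ∀ n → PrimRec F G (env ρ) n (value n)
    iterate zero    = compile-correct b ρ
    iterate (suc i) = value i , iterate i , _ ,
      Pair-correct Y (Comp Fst Snd) (Pair (Comp Snd Snd) Fst) x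
        (z , sym (π₂-⟨⟩ (env ρ) z) , sym (π₁-⟨⟩ i (value i)))
        (Pair-correct Y (Comp Snd Snd) Fst x
          (z , sym (π₂-⟨⟩ (env ρ) z) , sym (π₂-⟨⟩ i (value i)))
          (sym (π₁-⟨⟩ (env ρ) z))) ,
      compile-correct s (leaf i ∷ᵛ valueV i ∷ᵛ ρ)
      where
      z = ⟨ i , value i ⟩
      x = ⟨ env ρ , z ⟩
  compile-correct (call t ts) ρ = _ , compiles-correct ts ρ , compile-correct t (evals χ ts ρ)

  compiles-correct []ᵛ       ρ = refl
  compiles-correct (t ∷ᵛ ts) ρ =
    Pair-correct Y (compile t) (compiles ts) (env ρ) (compile-correct t ρ) (compiles-correct ts ρ)

code₁ : Tm 1 → Code
code₁ t = Comp (compile t) (Pair Id Zero)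

code₂ : Tm 2 → Code
code₂ t = Comp (compile t) (Pair Fst (Pair Snd Zero))

module _ {Y : Pred ℕ 0ℓ} {χ : ℕ → ℕ} (Yχ : Char Y χ) where
  code₁-correct : ∀ t x → ⟦ code₁ t ⟧ Y x (num (eval χ t (leaf x ∷ᵛ []ᵛ)))
  code₁-correct t x =
    _ , Pair-correct Y Id Zero x (Id-correct Y x) refl , compile-correct Yχ t (leaf x ∷ᵛ []ᵛ)

  code₂-correct : ∀ t x y → ⟦ code₂ t ⟧ Y ⟨ x , y ⟩ (num (eval χ t (leaf x ∷ᵛ leaf y ∷ᵛ []ᵛ)))
  code₂-correct t x y =
    _ , Pair-correct Y Fst (Pair Snd Zero) ⟨ x , y ⟩ (sym (π₁-⟨⟩ x y))
          (Pair-correct Y Snd Zero ⟨ x , y ⟩ (sym (π₂-⟨⟩ x y)) refl) ,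
    compile-correct Yχ t (leaf x ∷ᵛ leaf y ∷ᵛ []ᵛ)

0-char-∅ : Char ∅ (λ _ → 0)
0-char-∅ i = inj₂ ((λ ()) , refl)

-- Decoding program numbers

π₁≤ : ∀ n → π₁ n ≤ n
π₁≤ n = subst (π₁ n ≤_) (pair-unpair n)
  (≤-trans (m≤m+n (π₁ n) (π₂ n)) (≤-trans (n≤triangle (π₁ n + π₂ n)) (m≤m+n _ _)))
  where
  n≤triangle : ∀ n → n ≤ triangle n
  n≤triangle zero    = z≤n
  n≤triangle (suc n) = m≤m+n (suc n) (triangle n)

π₂≤ : ∀ n → π₂ n ≤ n
π₂≤ n = subst (π₂ n ≤_) (pair-unpair n) (m≤n+m (π₂ n) _)

π₂< : ∀ n t → π₁ n ≡ suc t → π₂ n < n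
π₂< n t e = subst (π₂ n <_) (trans (cong (λ a → ⟨ a , π₂ n ⟩) (sym e)) (pair-unpair n))
  (s≤s (m≤n+m (π₂ n) (t + π₂ n + triangle (t + π₂ n))))

-- Subprograms are decoded only under a nonzero tag. The tag equation is handed to the hypothesis
-- because it makes the payload strictly smaller than the program's number.
build-cong : ∀ {f g} t p → (∀ q t′ → t ≡ suc t′ → q ≤ p → f q ≡ g q) →
             build f t p ≡ build g t p
build-cong 0 p h = refl
build-cong 1 p h = refl
build-cong 2 p h = refl
build-cong 3 p h = refl
build-cong 4 p h = refl
build-cong 5 p h = cong₂ Pair (h _ _ refl (π₁≤ p)) (h _ _ refl (π₂≤ p))
build-cong 6 p h = cong₂ Comp (h _ _ refl (π₁≤ p)) (h _ _ refl (π₂≤ p))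
build-cong 7 p h = cong₂ Prec (h _ _ refl (π₁≤ p)) (h _ _ refl (π₂≤ p))
build-cong (suc (suc (suc (suc (suc (suc (suc (suc t)))))))) p h = cong Mu (h _ _ refl ≤-refl)

decodeWithin-stable : ∀ k l n → n < k → n < l → decodeWithin k n ≡ decodeWithin l n
decodeWithin-stable (suc k) (suc l) n (s≤s n≤k) (s≤s n≤l) =
  build-cong (π₁ n) (π₂ n) λ q t e q≤ →
    let q<n = ≤-<-trans q≤ (π₂< n t e) in
    decodeWithin-stable k l q (<-≤-trans q<n n≤k) (<-≤-trans q<n n≤l)

decode-unfold : ∀ n → decode n ≡ build decode (π₁ n) (π₂ n)
decode-unfold n = build-cong (π₁ n) (π₂ n) λ q t e q≤ →
  decodeWithin-stable n (suc q) q (≤-<-trans q≤ (π₂< n t e)) ≤-refl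

decode-tag : ∀ {n t} → π₁ n ≡ t → decode n ≡ build decode t (π₂ n)
decode-tag {n} e = trans (decode-unfold n) (cong (λ t → build decode t (π₂ n)) e)

decode-pair : ∀ t p → decode (pair t p) ≡ build decode t p
decode-pair t p = trans (decode-unfold (pair t p)) (cong₂ (build decode) (π₁-pair t p) (π₂-pair t p))

decode-Pair : ∀ a b → decode (pair 5 (pair a b)) ≡ Pair (decode a) (decode b)
decode-Pair a b = trans (decode-pair 5 (pair a b))
  (cong₂ (λ a b → Pair (decode a) (decode b)) (π₁-pair a b) (π₂-pair a b))

decode-Comp : ∀ a b → decode (pair 6 (pair a b)) ≡ Comp (decode a) (decode b)
decode-Comp a b = trans (decode-pair 6 (pair a b))
  (cong₂ (λ a b → Comp (decode a) (decode b)) (π₁-pair a b) (π₂-pair a b))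

-- The machine works on program numbers, so its completeness needs structural recursion on numbers;
-- this view supplies it in place of the fuel of `decodeWithin`. In `muᶜ` the tag is arbitrary from
-- 8 on, as in `build`.
data IsCode (e : ℕ) : Set where
  zeroᶜ   : π₁ e ≡ 0 → IsCode e
  succᶜ   : π₁ e ≡ 1 → IsCode e
  fstᶜ    : π₁ e ≡ 2 → IsCode e
  sndᶜ    : π₁ e ≡ 3 → IsCode e
  oracleᶜ : π₁ e ≡ 4 → IsCode e
  pairᶜ   : π₁ e ≡ 5 → IsCode (π₁ (π₂ e)) → IsCode (π₂ (π₂ e)) → IsCode e
  compᶜ   : π₁ e ≡ 6 → IsCode (π₁ (π₂ e)) → IsCode (π₂ (π₂ e)) → IsCode e
  precᶜ   : π₁ e ≡ 7 → IsCode (π₁ (π₂ e)) → IsCode (π₂ (π₂ e)) → IsCode e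
  muᶜ     : ∀ t → π₁ e ≡ 8 + t → IsCode (π₂ e) → IsCode e

isCode : ∀ e → IsCode e
isCode = <-rec IsCode λ e ih → byTag e (π₁ e) refl ih
  where
  byTag : ∀ e t → π₁ e ≡ t → (∀ {q} → q < e → IsCode q) → IsCode e
  byTag e 0 eq ih = zeroᶜ eq
  byTag e 1 eq ih = succᶜ eq
  byTag e 2 eq ih = fstᶜ eq
  byTag e 3 eq ih = sndᶜ eq
  byTag e 4 eq ih = oracleᶜ eq
  byTag e 5 eq ih = pairᶜ eq (ih (≤-<-trans (π₁≤ (π₂ e)) (π₂< e 4 eq)))
                             (ih (≤-<-trans (π₂≤ (π₂ e)) (π₂< e 4 eq)))
  byTag e 6 eq ih = compᶜ eq (ih (≤-<-trans (π₁≤ (π₂ e)) (π₂< e 5 eq)))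
                             (ih (≤-<-trans (π₂≤ (π₂ e)) (π₂< e 5 eq)))
  byTag e 7 eq ih = precᶜ eq (ih (≤-<-trans (π₁≤ (π₂ e)) (π₂< e 6 eq)))
                             (ih (≤-<-trans (π₂≤ (π₂ e)) (π₂< e 6 eq)))
  byTag e (suc (suc (suc (suc (suc (suc (suc (suc t)))))))) eq ih =
    muᶜ t eq (ih (π₂< e (7 + t) eq))

-- A stack machine

-- Frames hold program numbers rather than codes, so that states can be coded as numbers. In
-- `prec e x i n`, i counts the stages already started and n those still to come; in `mu e x j`, the
-- value at j is being computed.
data Frame : Set where
  pairL : (e x : ℕ) → Frame
  pairR : (a : ℕ) → Frame
  comp  : (e : ℕ) → Frame
  prec  : (e x i n : ℕ) → Frame
  mu    : (e x j : ℕ) → Frame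

data State : Set where
  ev  : (e x : ℕ) → List Frame → State
  ret : (y : ℕ) → List Frame → State

-- o i = 0 means that the oracle's answer on i is unknown, which blocks the
-- machine; o i = suc b means that the answer is b.
module _ (o : ℕ → ℕ) where
  answer : ℕ → State → List Frame → State
  answer zero    s K = s
  answer (suc b) s K = ret b K

  dispatch : ℕ → ℕ → ℕ → List Frame → State
  dispatch 0 e x K = ret 0 K
  dispatch 1 e x K = ret (suc x) K
  dispatch 2 e x K = ret (π₁ x) K
  dispatch 3 e x K = ret (π₂ x) K
  dispatch 4 e x K = answer (o x) (ev e x K) K
  dispatch 5 e x K = ev (π₁ (π₂ e)) x (pairL (π₂ (π₂ e)) x ∷ K)
  dispatch 6 e x K = ev (π₂ (π₂ e)) x (comp (π₁ (π₂ e)) ∷ K)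
  dispatch 7 e x K = ev (π₁ (π₂ e)) (π₁ x) (prec (π₂ (π₂ e)) (π₁ x) 0 (π₂ x) ∷ K)
  dispatch _ e x K = ev (π₂ e) (pair x 0) (mu (π₂ e) x 0 ∷ K)

  step : State → State
  step (ev e x K)                      = dispatch (π₁ e) e x K
  step (ret y [])                      = ret y []
  step (ret y (pairL e x ∷ K))         = ev e x (pairR y ∷ K)
  step (ret y (pairR a ∷ K))           = ret (pair a y) K
  step (ret y (comp e ∷ K))            = ev e y K
  step (ret y (prec e x i zero ∷ K))   = ret y K
  step (ret y (prec e x i (suc n) ∷ K)) = ev e (pair x (pair i y)) (prec e x (suc i) n ∷ K)
  step (ret zero (mu e x j ∷ K))       = ret j K
  step (ret (suc y) (mu e x j ∷ K))    = ev e (pair x (suc j)) (mu e x (suc j) ∷ K)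

  run : ℕ → State → State
  run zero    s = s
  run (suc t) s = step (run t s)

  run-+ : ∀ t u s → run (t + u) s ≡ run t (run u s)
  run-+ zero    u s = refl
  run-+ (suc t) u s = cong step (run-+ t u s)

  run-halted : ∀ t y → run t (ret y []) ≡ ret y []
  run-halted zero    y = refl
  run-halted (suc t) y = cong step (run-halted t y)

  run-stays : ∀ {t u s y} → t ≤ u → run t s ≡ ret y [] → run u s ≡ ret y []
  run-stays {t} {u} {s} {y} t≤u h = begin
    run u s                ≡⟨ cong (λ u → run u s) (sym (m∸n+n≡m t≤u)) ⟩
    run (u ∸ t + t) s      ≡⟨ run-+ (u ∸ t) t s ⟩
    run (u ∸ t) (run t s)  ≡⟨ cong (run (u ∸ t)) h ⟩
    run (u ∸ t) (ret y []) ≡⟨ run-halted (u ∸ t) y ⟩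
    ret y []               ∎
    where open ≡-Reasoning

init : ℕ → ℕ → State
init e x = ev e x []

flag : State → ℕ
flag (ev _ _ _)      = 1
flag (ret _ [])      = 0
flag (ret _ (_ ∷ _)) = 1

output : State → ℕ
output (ev _ _ _) = 0
output (ret y _)  = y

flag-0 : ∀ s → flag s ≡ 0 → s ≡ ret (output s) []
flag-0 (ret y []) refl = refl

-- Evaluations in which every result of a Mu is below d.
Within : ℕ → Code → Pred ℕ 0ℓ → ℕ → ℕ → Set
Within d (Pair c e) Y x y = ∃[ a ] ∃[ b ] (Within d c Y x a × Within d e Y x b × y ≡ ⟨ a , b ⟩)
Within d (Comp c e) Y x y = ∃[ a ] (Within d e Y x a × Within d c Y a y)
Within d (Prec c e) Y x y = PrimRec (Within d c Y) (Within d e Y) (π₁ x) (π₂ x) y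
Within d (Mu c)     Y x y = y < d × Within d c Y ⟨ x , y ⟩ 0
                          × (∀ j → j < y → ∃[ v ] Within d c Y ⟨ x , j ⟩ (suc v))
Within d c          Y x y = ⟦ c ⟧ Y x y

PrimRec-map : ∀ {F G F′ G′ : ℕ → ℕ → Set} → (∀ {x y} → F x y → F′ x y) → (∀ {x y} → G x y → G′ x y) →
              ∀ {x} n {y} → PrimRec F G x n y → PrimRec F′ G′ x n y
PrimRec-map f g zero    p           = f p
PrimRec-map f g (suc n) (r , p , q) = r , PrimRec-map f g n p , g q

Within-⟦⟧ : ∀ {d} c {Y x y} → Within d c Y x y → ⟦ c ⟧ Y x y
Within-⟦⟧ Zero       p = p
Within-⟦⟧ Succ       p = p
Within-⟦⟧ Fst        p = p
Within-⟦⟧ Snd        p = p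
Within-⟦⟧ Oracle     p = p
Within-⟦⟧ (Pair c e) (a , b , p , q , r) = a , b , Within-⟦⟧ c p , Within-⟦⟧ e q , r
Within-⟦⟧ (Comp c e) (a , p , q)         = a , Within-⟦⟧ e p , Within-⟦⟧ c q
Within-⟦⟧ (Prec c e) {x = x} p           = PrimRec-map (Within-⟦⟧ c) (Within-⟦⟧ e) (π₂ x) p
Within-⟦⟧ (Mu c)     (_ , p , q)         =
  Within-⟦⟧ c p , λ j j<y → proj₁ (q j j<y) , Within-⟦⟧ c (proj₂ (q j j<y))

Within-suc : ∀ {d} c {Y x y} → Within d c Y x y → Within (suc d) c Y x y
Within-suc Zero       p = p
Within-suc Succ       p = p
Within-suc Fst        p = p
Within-suc Snd        p = p
Within-suc Oracle     p = p
Within-suc (Pair c e) (a , b , p , q , r) = a , b , Within-suc c p , Within-suc e q , r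
Within-suc (Comp c e) (a , p , q)         = a , Within-suc e p , Within-suc c q
Within-suc (Prec c e) {x = x} p           = PrimRec-map (Within-suc c) (Within-suc e) (π₂ x) p
Within-suc (Mu c)     (y<d , p , q)       =
  m<n⇒m<1+n y<d , Within-suc c p , λ j j<y → proj₁ (q j j<y) , Within-suc c (proj₂ (q j j<y))

-- Soundness: what a state denotes (the final values its continuation can
-- produce) is inherited backwards along steps.  A search for a Mu that is at
-- j with d steps to go ends at most at j + d.
module _ (o : ℕ → ℕ) (Y : Pred ℕ 0ℓ)
         (sound : ∀ i b → o i ≡ suc b → ⟦ Oracle ⟧ Y i b) where
  private
    Ev : ℕ → ℕ → ℕ → ℕ → Set
    Ev d e = Within d (decode e) Y

    PrimRecFrom : ℕ → ℕ → ℕ → ℕ → ℕ → ℕ → ℕ → Set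
    PrimRecFrom d e x i zero    r y = r ≡ y
    PrimRecFrom d e x i (suc n) r y =
      ∃[ r′ ] (Ev d e (pair x (pair i r)) r′ × PrimRecFrom d e x (suc i) n r′ y)

    MuFrom : ℕ → ℕ → ℕ → ℕ → ℕ → Set
    MuFrom d e x j y = Ev d e (pair x y) 0
                     × (∀ i → j ≤ i → i < y → ∃[ v ] Ev d e (pair x i) (suc v))

    Frame⟦_⟧ : Frame → ℕ → ℕ → ℕ → Set
    Frame⟦ pairL e x ⟧    d v y = ∃[ b ] (Ev d e x b × y ≡ pair v b)
    Frame⟦ pairR a ⟧      d v y = y ≡ pair a v
    Frame⟦ comp e ⟧       d v y = Ev d e v y
    Frame⟦ prec e x i n ⟧ d v y = PrimRecFrom d e x i n v y
    Frame⟦ mu e x j ⟧     d v y =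
      y ≤ j + d × ((v ≡ 0 × y ≡ j) ⊎ (∃[ w ] (v ≡ suc w × MuFrom d e x (suc j) y)))

    Stack⟦_⟧ : List Frame → ℕ → ℕ → ℕ → Set
    Stack⟦ [] ⟧    d v z = v ≡ z
    Stack⟦ F ∷ K ⟧ d v z = ∃[ y ] (Frame⟦ F ⟧ d v y × Stack⟦ K ⟧ d y z)

    State⟦_⟧ : State → ℕ → ℕ → Set
    State⟦ ev e x K ⟧ d z = ∃[ y ] (Ev d e x y × Stack⟦ K ⟧ d y z)
    State⟦ ret y K ⟧  d z = Stack⟦ K ⟧ d y z

    Ev-suc : ∀ {d} e {x y} → Ev d e x y → Ev (suc d) e x y
    Ev-suc e = Within-suc (decode e)

    PrimRecFrom-suc : ∀ {d} e x i n {r y} → PrimRecFrom d e x i n r y → PrimRecFrom (suc d) e x i n r y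
    PrimRecFrom-suc e x i zero    p            = p
    PrimRecFrom-suc e x i (suc n) (r′ , p , q) = r′ , Ev-suc e p , PrimRecFrom-suc e x (suc i) n q

    MuFrom-suc : ∀ {d} e x j {y} → MuFrom d e x j y → MuFrom (suc d) e x j y
    MuFrom-suc e x j (p , q) =
      Ev-suc e p , λ i j≤i i<y → proj₁ (q i j≤i i<y) , Ev-suc e (proj₂ (q i j≤i i<y))

    Frame-suc : ∀ {d} F {v y} → Frame⟦ F ⟧ d v y → Frame⟦ F ⟧ (suc d) v y
    Frame-suc (pairL e x)    (b , p , q) = b , Ev-suc e p , q
    Frame-suc (pairR a)      p = p
    Frame-suc (comp e)       p = Ev-suc e p
    Frame-suc (prec e x i n) p = PrimRecFrom-suc e x i n p
    Frame-suc {d} (mu e x j) (y≤ , p) =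
      ≤-trans y≤ (+-monoʳ-≤ j (n≤1+n d)) ,
      map₂ (λ (w , q , r) → w , q , MuFrom-suc e x (suc j) r) p

    Stack-suc : ∀ {d} K {v z} → Stack⟦ K ⟧ d v z → Stack⟦ K ⟧ (suc d) v z
    Stack-suc []      p           = p
    Stack-suc (F ∷ K) (y , p , q) = y , Frame-suc F p , Stack-suc K q

    PrimRec-extend : ∀ {d} e {F} x i n {r y} → PrimRec F (Ev d e) x i r → PrimRecFrom d e x i n r y →
                     PrimRec F (Ev d e) x (n + i) y
    PrimRec-extend e x i zero    p refl         = p
    PrimRec-extend {d} e {F} x i (suc n) {y = y} p (r′ , q , q′) =
      subst (λ k → PrimRec F (Ev d e) x k y) (+-suc n i)
        (PrimRec-extend e x (suc i) n
          (_ , p , subst (λ z → Ev _ e z r′) (trans (pair-def x _) (cong ⟨ x ,_⟩ (pair-def i _))) q) q′)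

    MuFrom-extend : ∀ {d} e x j {v y} → Ev d e (pair x j) v →
      (v ≡ 0 × y ≡ j) ⊎ (∃[ w ] (v ≡ suc w × MuFrom d e x (suc j) y)) → MuFrom d e x j y
    MuFrom-extend e x j p (inj₁ (refl , refl)) = p , λ i j≤i i<j → ⊥-elim (<⇒≱ i<j j≤i)
    MuFrom-extend {d} e x j {y = y} p (inj₂ (w , refl , q , q′)) = q , earlier
      where
      earlier : ∀ i → j ≤ i → i < y → ∃[ v ] Ev d e (pair x i) (suc v)
      earlier i j≤i i<y with m≤n⇒m<n∨m≡n j≤i
      ... | inj₁ j<i  = q′ i j<i i<y
      ... | inj₂ refl = w , p

    module _ {d z : ℕ} where
      dispatch-sound : ∀ t e x K → decode e ≡ build decode t (π₂ e) →
                       State⟦ dispatch o t e x K ⟧ d z → State⟦ ev e x K ⟧ (suc d) z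
      dispatch-sound 4 e x K eq p with o x in eqo
      ... | zero with (y , p , q) ← p = y , Ev-suc e p , Stack-suc K q
      ... | suc b = b , subst (λ c → Within (suc d) c Y x b) (sym eq) (sound x b eqo) , Stack-suc K p
      dispatch-sound 0 e x K eq p rewrite eq = _ , refl , Stack-suc K p
      dispatch-sound 1 e x K eq p rewrite eq = _ , refl , Stack-suc K p
      dispatch-sound 2 e x K eq p rewrite eq = _ , refl , Stack-suc K p
      dispatch-sound 3 e x K eq p rewrite eq = _ , refl , Stack-suc K p
      dispatch-sound 5 e x K eq (a , p , y , (b , q , refl) , r) rewrite eq =
        _ , (a , b , Ev-suc (π₁ (π₂ e)) p , Ev-suc (π₂ (π₂ e)) q , pair-def a b) , Stack-suc K r
      dispatch-sound 6 e x K eq (a , p , y , q , r) rewrite eq =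
        _ , (a , Ev-suc (π₂ (π₂ e)) p , Ev-suc (π₁ (π₂ e)) q) , Stack-suc K r
      dispatch-sound 7 e x K eq (a , p , y , q , r) rewrite eq =
        _ , PrimRec-map (Ev-suc (π₁ (π₂ e))) (Ev-suc (π₂ (π₂ e))) (π₂ x)
              (subst (λ n → PrimRec (Ev d (π₁ (π₂ e))) (Ev d (π₂ (π₂ e))) (π₁ x) n y)
                     (+-identityʳ (π₂ x)) (PrimRec-extend (π₂ (π₂ e)) (π₁ x) 0 (π₂ x) p q)) ,
        Stack-suc K r
      dispatch-sound (suc (suc (suc (suc (suc (suc (suc (suc t)))))))) e x K eq
                     (a , p , y , (y≤ , q) , r) rewrite eq
        with h , h′ ← MuFrom-extend (π₂ e) x 0 p q =
        -- The search starts at 0 with d steps to go, so it ends at most at d, which is below the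
        -- new bound `suc d`.
        y , (s≤s y≤ ,
             Ev-suc (π₂ e) (subst (λ z → Ev d (π₂ e) z 0) (pair-def x y) h) ,
             λ j j<y → let v , g = h′ j z≤n j<y in
               v , Ev-suc (π₂ e) (subst (λ z → Ev d (π₂ e) z (suc v)) (pair-def x j) g)) ,
        Stack-suc K r

      step-sound : ∀ s → State⟦ step o s ⟧ d z → State⟦ s ⟧ (suc d) z
      step-sound (ev e x K) p = dispatch-sound (π₁ e) e x K (decode-unfold e) p
      step-sound (ret y []) p = p
      step-sound (ret y (pairL e x ∷ K)) (b , p , _ , refl , q) =
        _ , (b , Ev-suc e p , refl) , Stack-suc K q
      step-sound (ret y (pairR a ∷ K)) p = _ , refl , Stack-suc K p
      step-sound (ret y (comp e ∷ K)) (b , p , q) = b , Ev-suc e p , Stack-suc K q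
      step-sound (ret y (prec e x i zero ∷ K)) p = _ , refl , Stack-suc K p
      step-sound (ret y (prec e x i (suc n) ∷ K)) (b , p , y′ , q , r) =
        y′ , (b , Ev-suc e p , PrimRecFrom-suc e x (suc i) n q) , Stack-suc K r
      step-sound (ret zero (mu e x j ∷ K)) p =
        j , (m≤m+n j (suc d) , inj₁ (refl , refl)) , Stack-suc K p
      step-sound (ret (suc v) (mu e x j ∷ K)) (b , p , y , (y≤ , q) , r) =
        y , (subst (y ≤_) (sym (+-suc j d)) y≤ ,
             inj₂ (v , refl , MuFrom-suc e x (suc j) (MuFrom-extend e x (suc j) p q))) ,
        Stack-suc K r

    run-sound′ : ∀ t {d s z} → State⟦ run o t s ⟧ d z → State⟦ s ⟧ (t + d) z
    run-sound′ zero    p = p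
    run-sound′ (suc t) {d} {s} {z} p =
      subst (λ d → State⟦ s ⟧ d z) (+-suc t d) (run-sound′ t (step-sound (run o t s) p))

  -- A halted state denotes its output already at bound 0, and each step backwards raises the bound
  -- by one. Hence the running time bounds every result of a `Mu`.
  run-sound : ∀ t {e x y} → run o t (init e x) ≡ ret y [] → Within t (decode e) Y x y
  run-sound t {e} {x} {y} h
    with _ , p , refl ← run-sound′ t {0} {init e x} {y}
                          (subst (λ s → State⟦ s ⟧ 0 y) (sym h) refl) =
    subst (λ d → Within d (decode e) Y x y) (+-identityʳ t) p

-- Completeness of the machine

module _ (o : ℕ → ℕ) (Y : Pred ℕ 0ℓ)
         (answers : ∀ i b → ⟦ Oracle ⟧ Y i b → o i ≡ suc b) where
  private
    infix 4 _⇝_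
    _⇝_ : State → State → Set
    s ⇝ s′ = ∃[ t ] run o t s ≡ s′

    infixr 5 _▷_
    _▷_ : ∀ {s s′ s″} → s ⇝ s′ → s′ ⇝ s″ → s ⇝ s″
    _▷_ {s} (t , p) (u , q) = u + t , trans (run-+ o u t s) (trans (cong (run o u) p) q)

    enter : ∀ {e t} x K → π₁ e ≡ t → ev e x K ⇝ dispatch o t e x K
    enter {e} x K eq = 1 , cong (λ t → dispatch o t e x K) eq

    decoded : ∀ e {t} x y → π₁ e ≡ t → ⟦ decode e ⟧ Y x y → ⟦ build decode t (π₂ e) ⟧ Y x y
    decoded e x y eq = subst (λ c → ⟦ c ⟧ Y x y) (decode-tag {e} eq)

  -- The continuation `K` is arbitrary so that the runs of subprograms, which happen on larger
  -- stacks, can be concatenated.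
  ev-complete : ∀ {e} → IsCode e → ∀ {x y} → ⟦ decode e ⟧ Y x y → ∀ K → ev e x K ⇝ ret y K
  ev-complete {e} (zeroᶜ eq) {x} {y} p K with refl ← decoded e x y eq p = enter x K eq
  ev-complete {e} (succᶜ eq) {x} {y} p K with refl ← decoded e x y eq p = enter x K eq
  ev-complete {e} (fstᶜ eq) {x} {y} p K with refl ← decoded e x y eq p = enter x K eq
  ev-complete {e} (sndᶜ eq) {x} {y} p K with refl ← decoded e x y eq p = enter x K eq
  ev-complete {e} (oracleᶜ eq) {x} {y} p K =
    enter x K eq ▷ (0 , cong (λ a → answer o a (ev e x K) K) (answers _ _ (decoded e x y eq p)))
  ev-complete {e} (pairᶜ eq c d) {x} {y} p K with a , b , p , q , refl ← decoded e x y eq p =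
    enter x K eq ▷ ev-complete c p _ ▷ (1 , refl) ▷ ev-complete d q _ ▷
    (1 , cong (λ y → ret y K) (pair-def a b))
  ev-complete {e} (compᶜ eq c d) {x} {y} p K with a , p , q ← decoded e x y eq p =
    enter x K eq ▷ ev-complete d p _ ▷ (1 , refl) ▷ ev-complete c q K
  ev-complete {e} (precᶜ eq c d) {x} {y} p K =
    enter x K eq ▷
    subst (λ n → ev e₁ (π₁ x) (prec e₂ (π₁ x) 0 n ∷ K) ⇝ ret y (prec e₂ (π₁ x) (π₂ x) 0 ∷ K))
          (+-identityʳ (π₂ x))
          (start (π₂ x) 0 (decoded e x y eq p)) ▷
    (1 , refl)
    where
    e₁ = π₁ (π₂ e)
    e₂ = π₂ (π₂ e)
    F = ⟦ decode e₁ ⟧ Y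
    G = ⟦ decode e₂ ⟧ Y
    start : ∀ i n {y} → PrimRec F G (π₁ x) i y →
            ev e₁ (π₁ x) (prec e₂ (π₁ x) 0 (i + n) ∷ K) ⇝ ret y (prec e₂ (π₁ x) i n ∷ K)
    start zero    n p = ev-complete c p _
    start (suc i) n {y} (r , p , q) =
      subst (λ m → ev e₁ (π₁ x) (prec e₂ (π₁ x) 0 m ∷ K) ⇝ ret r (prec e₂ (π₁ x) i (suc n) ∷ K))
            (+-suc i n) (start i (suc n) p) ▷
      (1 , refl) ▷
      ev-complete d (subst (λ z → G z y) (sym (trans (pair-def _ _) (cong ⟨ π₁ x ,_⟩ (pair-def i r)))) q) _
  ev-complete {e} (muᶜ t eq c) {x} {y} p K with p , q ← decoded e x y eq p =
    enter x K eq ▷ search y 0 (sym (+-identityʳ y))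
    where
    search : ∀ k j → y ≡ k + j → ev (π₂ e) (pair x j) (mu (π₂ e) x j ∷ K) ⇝ ret y K
    search zero    j refl =
      ev-complete c (subst (λ z → ⟦ decode (π₂ e) ⟧ Y z 0) (sym (pair-def x j)) p) _ ▷ (1 , refl)
    search (suc k) j eq′ with v , h ← q j (subst (j <_) (sym eq′) (s≤s (m≤n+m j k))) =
      ev-complete c (subst (λ z → ⟦ decode (π₂ e) ⟧ Y z (suc v)) (sym (pair-def x j)) h) _ ▷
      (1 , refl) ▷ search k (suc j) (trans eq′ (sym (+-suc k j)))

  run-complete : ∀ {e x y} → ⟦ decode e ⟧ Y x y → ∃[ t ] run o t (init e x) ≡ ret y []
  run-complete {e} p = ev-complete (isCode e) p []

-- Use principle: one step consults the oracle at most at the current input x, so `suc x` bounds its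
-- queries, and a run takes the maximum over its steps.
use : ∀ o t s → ∃[ N ] (∀ o′ → (∀ i → i < N → o′ i ≡ o i) → run o′ t s ≡ run o t s)
use o zero    s = 0 , λ o′ h → refl
use o (suc t) s with N , h ← use o t s =
  N ⊔ bound (run o t s) , λ o′ a →
    trans (cong (step o′) (h o′ (λ i i<N → a i (<-≤-trans i<N (m≤m⊔n N _)))))
          (step-use o′ (run o t s) (λ i i<b → a i (<-≤-trans i<b (m≤n⊔m N _))))
  where
  bound : State → ℕ
  bound (ev e x K) = suc x
  bound (ret y K)  = 0
  dispatch-use : ∀ o′ t e x K → o′ x ≡ o x → dispatch o′ t e x K ≡ dispatch o t e x K
  dispatch-use o′ 0 e x K h = refl
  dispatch-use o′ 1 e x K h = refl
  dispatch-use o′ 2 e x K h = refl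
  dispatch-use o′ 3 e x K h = refl
  dispatch-use o′ 4 e x K h rewrite h = answer-irrelevant (o x)
    where
    answer-irrelevant : ∀ a → answer o′ a (ev e x K) K ≡ answer o a (ev e x K) K
    answer-irrelevant zero    = refl
    answer-irrelevant (suc b) = refl
  dispatch-use o′ 5 e x K h = refl
  dispatch-use o′ 6 e x K h = refl
  dispatch-use o′ 7 e x K h = refl
  dispatch-use o′ (suc (suc (suc (suc (suc (suc (suc (suc t)))))))) e x K h = refl
  step-use : ∀ o′ s → (∀ i → i < bound s → o′ i ≡ o i) → step o′ s ≡ step o s
  step-use o′ (ev e x K) h = dispatch-use o′ (π₁ e) e x K (h x ≤-refl)
  step-use o′ (ret y []) h = refl
  step-use o′ (ret y (pairL e x ∷ K)) h = refl
  step-use o′ (ret y (pairR a ∷ K)) h = refl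
  step-use o′ (ret y (comp e ∷ K)) h = refl
  step-use o′ (ret y (prec e x i zero ∷ K)) h = refl
  step-use o′ (ret y (prec e x i (suc n) ∷ K)) h = refl
  step-use o′ (ret zero (mu e x j ∷ K)) h = refl
  step-use o′ (ret (suc y) (mu e x j ∷ K)) h = refl

-- The machine as a primitive recursive program

wk : ∀ {n} → Tm n → Tm (2 + n)
wk t = call t (tabulate (λ i → var (suc (suc i))))

predᵗ : ∀ {n} → Tm n → Tm n
predᵗ t = case t (lit 0) v0

ifz : ∀ {n} → Tm n → Tm n → Tm n → Tm n
ifz t a b = case t a (wk b)

-- The last branch catches all larger values.
switch : ∀ {n} → Tm n → List (Tm n) → Tm n → Tm n
switch t []       d = d
switch t (b ∷ bs) d = ifz t b (switch (predᵗ t) bs d)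

-- Since the first projection of 0 is 0 and all frames have positive tags, a tag test recognises the
-- empty stack.
stackV : List Frame → Val
stackV []                   = leaf 0
stackV (pairL e x ∷ K)      = node (leaf 1) (node (node (leaf e) (leaf x)) (stackV K))
stackV (pairR a ∷ K)        = node (leaf 2) (node (leaf a) (stackV K))
stackV (comp e ∷ K)         = node (leaf 3) (node (leaf e) (stackV K))
stackV (prec e x i n ∷ K)   =
  node (leaf 4) (node (node (node (leaf e) (leaf x)) (node (leaf i) (leaf n))) (stackV K))
stackV (mu e x j ∷ K)       = node (leaf 5) (node (node (node (leaf e) (leaf x)) (leaf j)) (stackV K))

stateV : State → Val
stateV (ev e x K) = node (leaf 0) (node (node (leaf e) (leaf x)) (stackV K))
stateV (ret y K)  = node (leaf 1) (node (leaf y) (stackV K))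

evᵗ : ∀ {n} → Tm n → Tm n → Tm n → Tm n
evᵗ e x K = lit 0 ,ᵗ (e ,ᵗ x) ,ᵗ K

retᵗ : ∀ {n} → Tm n → Tm n → Tm n
retᵗ y K = lit 1 ,ᵗ y ,ᵗ K

answerᵗ : Tm 2
answerᵗ = case v0 v1 (retᵗ v0 (sndᵗ (sndᵗ v3)))

-- The oracle is given by a term askᵗ of the query and of a parameter.
module _ (askᵗ : Tm 2) where
  dispatchᵗ : Tm 3
  dispatchᵗ = switch v0
    ( retᵗ (lit 0) K
    ∷ retᵗ (sucᵗ x) K
    ∷ retᵗ (fstᵗ x) K
    ∷ retᵗ (sndᵗ x) K
    ∷ call answerᵗ (call askᵗ (x ∷ᵛ v2 ∷ᵛ []ᵛ) ∷ᵛ v1 ∷ᵛ []ᵛ)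
    ∷ evᵗ (fstᵗ p) x (lit 1 ,ᵗ (sndᵗ p ,ᵗ x) ,ᵗ K)
    ∷ evᵗ (sndᵗ p) x (lit 3 ,ᵗ fstᵗ p ,ᵗ K)
    ∷ evᵗ (fstᵗ p) (fstᵗ x) (lit 4 ,ᵗ ((sndᵗ p ,ᵗ fstᵗ x) ,ᵗ (lit 0 ,ᵗ sndᵗ x)) ,ᵗ K)
    ∷ [])
    (evᵗ p (flat (x ,ᵗ lit 0)) (lit 5 ,ᵗ ((p ,ᵗ x) ,ᵗ lit 0) ,ᵗ K))
    where
    x = sndᵗ (fstᵗ (sndᵗ v1))
    p = sndᵗ (fstᵗ (fstᵗ (sndᵗ v1)))
    K = sndᵗ (sndᵗ v1)

  returnᵗ : Tm 1
  returnᵗ = switch (fstᵗ (sndᵗ (sndᵗ v0)))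
    ( v0
    ∷ evᵗ (fstᵗ D) (sndᵗ D) (lit 2 ,ᵗ y ,ᵗ K)
    ∷ retᵗ (flat (D ,ᵗ y)) K
    ∷ evᵗ D y K
    ∷ ifz n (retᵗ y K) (evᵗ e (flat (x ,ᵗ i ,ᵗ y)) (lit 4 ,ᵗ ((e ,ᵗ x) ,ᵗ (sucᵗ i ,ᵗ predᵗ n)) ,ᵗ K))
    ∷ [])
    (ifz y (retᵗ (sndᵗ D) K)
           (evᵗ e (flat (x ,ᵗ sucᵗ (sndᵗ D))) (lit 5 ,ᵗ ((e ,ᵗ x) ,ᵗ sucᵗ (sndᵗ D)) ,ᵗ K)))
    where
    y = fstᵗ (sndᵗ v0)
    D = fstᵗ (sndᵗ (sndᵗ (sndᵗ v0)))
    K = sndᵗ (sndᵗ (sndᵗ (sndᵗ v0)))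
    e = fstᵗ (fstᵗ D)
    x = sndᵗ (fstᵗ D)
    i = fstᵗ (sndᵗ D)
    n = sndᵗ (sndᵗ D)

  stepᵗ : Tm 2
  stepᵗ = ifz (fstᵗ v0)
    (call dispatchᵗ (fstᵗ (fstᵗ (fstᵗ (sndᵗ v0))) ∷ᵛ v0 ∷ᵛ v1 ∷ᵛ []ᵛ))
    (call returnᵗ (v0 ∷ᵛ []ᵛ))

  runᵗ : Tm 3
  runᵗ = rec v0 v1 (call stepᵗ (v1 ∷ᵛ v4 ∷ᵛ []ᵛ))

  module _ {χ o : ℕ → ℕ} {p : Val} (asked : ∀ x → num (eval χ askᵗ (leaf x ∷ᵛ p ∷ᵛ []ᵛ)) ≡ o x) where
    eval-answer : ∀ a e x K → eval χ answerᵗ (leaf a ∷ᵛ stateV (ev e x K) ∷ᵛ []ᵛ) ≡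
                  stateV (answer o a (ev e x K) K)
    eval-answer zero    e x K = refl
    eval-answer (suc a) e x K = refl

    eval-dispatch : ∀ t e x K → eval χ dispatchᵗ (leaf t ∷ᵛ stateV (ev e x K) ∷ᵛ p ∷ᵛ []ᵛ) ≡
                    stateV (dispatch o t e x K)
    eval-dispatch 0 e x K = refl
    eval-dispatch 1 e x K = refl
    eval-dispatch 2 e x K = refl
    eval-dispatch 3 e x K = refl
    eval-dispatch 4 e x K =
      trans (cong (natrec _ _) (asked x)) (eval-answer (o x) e x K)
    eval-dispatch 5 e x K = refl
    eval-dispatch 6 e x K = refl
    eval-dispatch 7 e x K = refl
    eval-dispatch (suc (suc (suc (suc (suc (suc (suc (suc t)))))))) e x K = refl

    eval-step : ∀ s → eval χ stepᵗ (stateV s ∷ᵛ p ∷ᵛ []ᵛ) ≡ stateV (step o s)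
    eval-step (ev e x K) = eval-dispatch (π₁ e) e x K
    eval-step (ret y []) = refl
    eval-step (ret y (pairL e x ∷ K)) = refl
    eval-step (ret y (pairR a ∷ K)) = refl
    eval-step (ret y (comp e ∷ K)) = refl
    eval-step (ret y (prec e x i zero ∷ K)) = refl
    eval-step (ret y (prec e x i (suc n) ∷ K)) = refl
    eval-step (ret zero (mu e x j ∷ K)) = refl
    eval-step (ret (suc y) (mu e x j ∷ K)) = refl

    eval-run : ∀ t s → eval χ runᵗ (leaf t ∷ᵛ stateV s ∷ᵛ p ∷ᵛ []ᵛ) ≡ stateV (run o t s)
    eval-run zero    s = refl
    eval-run (suc t) s =
      trans (cong (λ v → eval χ stepᵗ (v ∷ᵛ p ∷ᵛ []ᵛ)) (eval-run t s)) (eval-step (run o t s))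

flagᵗ : Tm 1
flagᵗ = ifz (fstᵗ v0) (lit 1) (ifz (fstᵗ (sndᵗ (sndᵗ v0))) (lit 0) (lit 1))

eval-flag : ∀ {χ} s → eval χ flagᵗ (stateV s ∷ᵛ []ᵛ) ≡ leaf (flag s)
eval-flag (ev e x K) = refl
eval-flag (ret y []) = refl
eval-flag (ret y (pairL e x ∷ K)) = refl
eval-flag (ret y (pairR a ∷ K)) = refl
eval-flag (ret y (comp e ∷ K)) = refl
eval-flag (ret y (prec e x i n ∷ K)) = refl
eval-flag (ret y (mu e x j ∷ K)) = refl

outputᵗ : Tm 1
outputᵗ = ifz (fstᵗ v0) (lit 0) (fstᵗ (sndᵗ v0))

eval-output : ∀ {χ} s → eval χ outputᵗ (stateV s ∷ᵛ []ᵛ) ≡ leaf (output s)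
eval-output (ev e x K) = refl
eval-output (ret y K)  = refl

opaque
  ⌜_⌝ : Code → ℕ
  ⌜ c ⌝ = encode c

  decode-⌜⌝ : ∀ c → decode ⌜ c ⌝ ≡ c
  decode-⌜⌝ = decode-encode

-- Unbounded search

module _ (Y : Pred ℕ 0ℓ) (c : Code) (x : ℕ) (f : ℕ → ℕ) (c-f : ∀ j → ⟦ c ⟧ Y ⟨ x , j ⟩ (f j)) where
  Mu-search : ∀ t → f t ≡ 0 → ∃[ y ] ⟦ Mu c ⟧ Y x y
  Mu-search t ft≡0 = from t 0 (trans (cong f (+-identityʳ t)) ft≡0) λ j ()
    where
    from : ∀ k j → f (k + j) ≡ 0 → (∀ i → i < j → ∃[ v ] ⟦ c ⟧ Y ⟨ x , i ⟩ (suc v)) →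
           ∃[ y ] ⟦ Mu c ⟧ Y x y
    from k j h below with f j in fj
    ... | zero = j , subst (⟦ c ⟧ Y _) fj (c-f j) , below
    from zero    j h below | suc v with () ← trans (sym h) fj
    from (suc k) j h below | suc v = from k (suc j) (trans (cong f (+-suc k j)) h) below′
      where
      below′ : ∀ i → i < suc j → ∃[ v ] ⟦ c ⟧ Y ⟨ x , i ⟩ (suc v)
      below′ i (s≤s i≤j) with m≤n⇒m<n∨m≡n i≤j
      ... | inj₁ i<j  = below i i<j
      ... | inj₂ refl = v , subst (⟦ c ⟧ Y _) fj (c-f j)

  Mu-result : ∀ {y} → ⟦ Mu c ⟧ Y x y → f y ≡ 0
  Mu-result {y} (p , _) = ⟦⟧-functional c Y ⟨ x , y ⟩ (c-f y) p

-- A universal program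

-- In the machine's convention 1 is the known answer 0, so every query is answered negatively and
-- none blocks.
no-oracle : ℕ → ℕ
no-oracle _ = 1

no-oracle-sound : ∀ i b → no-oracle i ≡ suc b → ⟦ Oracle ⟧ ∅ i b
no-oracle-sound i zero refl = 0-char-∅ i

no-oracle-answers : ∀ i b → ⟦ Oracle ⟧ ∅ i b → no-oracle i ≡ suc b
no-oracle-answers i b (inj₂ (_ , refl)) = refl

run∅ : ℕ → State → State
run∅ = run no-oracle

φ-run : ∀ {n m c} → φ n m c → ∃[ t ] run∅ t (init n m) ≡ ret c []
φ-run {n} {m} {c} = run-complete no-oracle ∅ no-oracle-answers {n} {m} {c}

run-Within : ∀ t n m {c} → run∅ t (init n m) ≡ ret c [] → Within t (decode n) ∅ m c
run-Within t n m {c} = run-sound no-oracle ∅ no-oracle-sound t {n} {m} {c}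

run-φ : ∀ t n m {c} → run∅ t (init n m) ≡ ret c [] → φ n m c
run-φ t n m {c} h = Within-⟦⟧ {t} (decode n) {∅} {m} {c} (run-Within t n m h)

opaque
  run∅ᵗ : Tm 3
  run∅ᵗ = call (runᵗ (lit 1)) (v0 ∷ᵛ evᵗ v1 v2 (lit 0) ∷ᵛ lit 0 ∷ᵛ []ᵛ)

  eval-run∅ : ∀ {χ} t n m →
              eval χ run∅ᵗ (leaf t ∷ᵛ leaf n ∷ᵛ leaf m ∷ᵛ []ᵛ) ≡ stateV (run∅ t (init n m))
  eval-run∅ {χ} t n m = eval-run (lit 1) {χ} {no-oracle} {leaf 0} (λ _ → refl) t (init n m)

simulateᵗ : Tm 2
simulateᵗ = call run∅ᵗ (v1 ∷ᵛ fstᵗ v0 ∷ᵛ sndᵗ v0 ∷ᵛ []ᵛ)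

haltedC outputC : Code
haltedC = code₂ (call flagᵗ (simulateᵗ ∷ᵛ []ᵛ))
outputC = code₂ (call outputᵗ (simulateᵗ ∷ᵛ []ᵛ))

private
  simulate : ℕ → ℕ → State
  simulate x t = run∅ t (init (π₁ x) (π₂ x))

  halted-correct : ∀ x t → ⟦ haltedC ⟧ ∅ ⟨ x , t ⟩ (flag (simulate x t))
  halted-correct x t = subst (⟦ haltedC ⟧ ∅ ⟨ x , t ⟩)
    (cong num (trans (cong (λ s → eval (λ _ → 0) flagᵗ (s ∷ᵛ []ᵛ)) (eval-run∅ {λ _ → 0} t (π₁ x) (π₂ x)))
                     (eval-flag {λ _ → 0} (simulate x t))))
    (code₂-correct 0-char-∅ (call flagᵗ (simulateᵗ ∷ᵛ []ᵛ)) x t)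

  output-correct : ∀ x t → ⟦ outputC ⟧ ∅ ⟨ x , t ⟩ (output (simulate x t))
  output-correct x t = subst (⟦ outputC ⟧ ∅ ⟨ x , t ⟩)
    (cong num (trans (cong (λ s → eval (λ _ → 0) outputᵗ (s ∷ᵛ []ᵛ)) (eval-run∅ {λ _ → 0} t (π₁ x) (π₂ x)))
                     (eval-output {λ _ → 0} (simulate x t))))
    (code₂-correct 0-char-∅ (call outputᵗ (simulateᵗ ∷ᵛ []ᵛ)) x t)

  simulate-pair : ∀ n m t → simulate ⟨ n , m ⟩ t ≡ run∅ t (init n m)
  simulate-pair n m t = cong₂ (λ n m → run∅ t (init n m)) (π₁-⟨⟩ n m) (π₂-⟨⟩ n m)

Within-functional : ∀ d c Y x {y z} → ⟦ c ⟧ Y x y → Within d c Y x z → y ≡ z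
Within-functional d c Y x {y} {z} p q = ⟦⟧-functional c Y x p (Within-⟦⟧ {d} c {Y} {x} {z} q)

opaque
  -- Kleene normal form: search for a halting time, then read off the output. That the halting time
  -- is the result of a `Mu` is essential, since `Within d` then forces the simulated run to take
  -- fewer than d steps.
  universal : Code
  universal = Comp outputC (Pair Id (Mu haltedC))

  universal-complete : ∀ {n m c} → φ n m c → ⟦ universal ⟧ ∅ ⟨ n , m ⟩ c
  universal-complete {n} {m} {c} p =
    let x = ⟨ n , m ⟩
        t , h = φ-run {n} {m} {c} p
        u , q = Mu-search ∅ haltedC x (λ t → flag (simulate x t)) (halted-correct x) t
                  (cong flag (trans (simulate-pair n m t) h))
        halt : run∅ u (init n m) ≡ ret (output (run∅ u (init n m))) []
        halt = flag-0 (run∅ u (init n m)) (trans (cong flag (sym (simulate-pair n m u)))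
                               (Mu-result ∅ haltedC x (λ t → flag (simulate x t)) (halted-correct x) q))
        out : output (simulate x u) ≡ c
        out = trans (cong output (simulate-pair n m u))
                    (⟦⟧-functional (decode n) ∅ m (run-φ u n m halt) p)
    in ⟨ x , u ⟩ , (x , u , Id-correct ∅ x , q , refl) ,
       subst (⟦ outputC ⟧ ∅ ⟨ x , u ⟩) out (output-correct x u)

  universal-sound : ∀ {d n m c} → Within d universal ∅ ⟨ n , m ⟩ c →
                    ∃[ t ] (t < d × run∅ t (init n m) ≡ ret c [])
  universal-sound {d} {n} {m} {c} (z , (x , t , i , (t<d , p , _) , refl) , q)
    with refl ← Within-functional d Id ∅ ⟨ n , m ⟩ (Id-correct ∅ ⟨ n , m ⟩) i =
    t , t<d , trans halt (cong (λ y → ret y []) out)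
    where
    halt : run∅ t (init n m) ≡ ret (output (run∅ t (init n m))) []
    halt = flag-0 _ (trans (cong flag (sym (simulate-pair n m t)))
      (Within-functional d haltedC ∅ ⟨ x , t ⟩ (halted-correct x t) p))
    out : output (run∅ t (init n m)) ≡ c
    out = trans (cong output (sym (simulate-pair n m t)))
      (Within-functional d outputC ∅ ⟨ x , t ⟩ (output-correct x t) q)

-- Bounded quantifiers

if0 : ℕ → ℕ → ℕ → ℕ
if0 zero    a b = a
if0 (suc _) a b = b

eval-if0 : ∀ r a b → natrec (leaf a) (λ _ _ → leaf b) r ≡ leaf (if0 r a b)
eval-if0 zero    a b = refl
eval-if0 (suc r) a b = refl

-- Here 0 is truth, as for `Mu`; hence the empty disjunction is 1 and the empty conjunction is 0.
some all : (ℕ → ℕ) → ℕ → ℕ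
some f zero    = 1
some f (suc n) = if0 (some f n) 0 (f n)
all f zero    = 0
all f (suc n) = if0 (all f n) (f n) 1

some-elim : ∀ f n → some f n ≡ 0 → ∃[ i ] (i < n × f i ≡ 0)
some-elim f (suc n) h with some f n in eq
... | zero  with i , i<n , p ← some-elim f n eq = i , m<n⇒m<1+n i<n , p
... | suc _ = n , ≤-refl , h

some-intro : ∀ f {n i} → i < n → f i ≡ 0 → some f n ≡ 0
some-intro f {suc n} {i} (s≤s i≤n) p with some f n in eq
... | zero  = refl
... | suc _ with m≤n⇒m<n∨m≡n i≤n
...   | inj₂ refl = p
...   | inj₁ i<n with () ← trans (sym (some-intro f i<n p)) eq

all-elim : ∀ f {n i} → all f n ≡ 0 → i < n → f i ≡ 0
all-elim f {suc n} {i} h (s≤s i≤n) with all f n in eq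
... | zero with m≤n⇒m<n∨m≡n i≤n
...   | inj₂ refl = h
...   | inj₁ i<n  = all-elim f eq i<n

all-intro : ∀ f n → (∀ i → i < n → f i ≡ 0) → all f n ≡ 0
all-intro f zero    h = refl
all-intro f (suc n) h rewrite all-intro f n (λ i i<n → h i (m<n⇒m<1+n i<n)) = h n ≤-refl

-- A number is also read as an infinite sequence of numbers, almost all zero.
nth : ℕ → ℕ → ℕ
nth zero    w = π₁ w
nth (suc i) w = nth i (π₂ w)

nth-0 : ∀ i → nth i 0 ≡ 0
nth-0 zero    = refl
nth-0 (suc i) = nth-0 i

nth-zero : ∀ a w → nth 0 (pair a w) ≡ a
nth-zero = π₁-pair

nth-suc : ∀ i a w → nth (suc i) (pair a w) ≡ nth i w
nth-suc i a w = cong (nth i) (π₂-pair a w)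

positive : ℕ → Bool
positive zero    = false
positive (suc _) = true

bit : Bool → ℕ
bit false = 0
bit true  = 1

-- The largest code of a sequence of n binary digits.
ones : ℕ → ℕ
ones zero    = 0
ones (suc n) = pair 1 (ones n)

pair-mono : ∀ {a b c d} → a ≤ c → b ≤ d → pair a b ≤ pair c d
pair-mono {a} {b} {c} {d} p q =
  subst₂ _≤_ (sym (pair-def a b)) (sym (pair-def c d)) (+-mono-≤ (triangle-mono (+-mono-≤ p q)) q)
  where
  triangle-mono : ∀ {m n} → m ≤ n → triangle m ≤ triangle n
  triangle-mono z≤n     = z≤n
  triangle-mono (s≤s p) = +-mono-≤ (s≤s p) (triangle-mono p)

-- This makes quantification over oracle prefixes of length n a bounded one. Numbers up to `ones n`
-- with other entries do no harm: read through `positive`, they only repeat prefixes that occur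
-- anyway.
digits : ∀ (b : ℕ → Bool) n → ∃[ w ] (w ≤ ones n × (∀ i → i < n → positive (nth i w) ≡ b i))
digits b zero    = 0 , z≤n , λ i ()
digits b (suc n) with w , w≤ , h ← digits (λ i → b (suc i)) n =
  pair (bit (b 0)) w , pair-mono (bit≤1 (b 0)) w≤ , digit
  where
  bit≤1 : ∀ β → bit β ≤ 1
  bit≤1 false = z≤n
  bit≤1 true  = s≤s z≤n
  positive-bit : ∀ β → positive (bit β) ≡ β
  positive-bit false = refl
  positive-bit true  = refl
  digit : ∀ i → i < suc n → positive (nth i (pair (bit (b 0)) w)) ≡ b i
  digit zero    _         = trans (cong positive (π₁-pair _ w)) (positive-bit (b 0))
  digit (suc i) (s≤s i<n) = trans (cong positive (nth-suc i _ w)) (h i i<n)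

-- The first n binary digits of w as a partial oracle for the machine.
prefix : ℕ → ℕ → ℕ → ℕ
prefix n w i = if0 (n ∸ i) 0 (suc (bit (positive (nth i w))))

prefix-known : ∀ n w i {b} → prefix n w i ≡ suc b → i < n × b ≡ bit (positive (nth i w))
prefix-known n w i h with n ∸ i in eq
prefix-known n w i refl | suc k =
  m∸n≢0⇒n<m (λ e → 1+n≢0 (trans (sym eq) e)) , refl

prefix-< : ∀ {n} w {i} → i < n → prefix n w i ≡ suc (bit (positive (nth i w)))
prefix-< {n} w {i} i<n with n ∸ i in eq
... | zero  = ⊥-elim (m<n⇒n≢0 i<n (⊥-elim (<⇒≱ i<n (m∸n≡0⇒m≤n eq))))
... | suc _ = refl

-- Entries of the list D are shifted by one, so that 0 marks the end.  As with
-- Mu, the value 0 signals success: here, that the program listed at i halts on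
-- itself.
trial : ℕ → ℕ → ℕ → State
trial n w e = run (prefix n w) n (init e e)

missAt : ℕ → ℕ → ℕ → ℕ
missAt n w zero    = 1
missAt n w (suc e) = flag (trial n w e)

miss : ℕ → ℕ → ℕ → ℕ → ℕ
miss n w D i = missAt n w (nth i D)

refuted : ℕ → ℕ → ℕ → ℕ
refuted n w D = some (miss n w D) (suc n)

check : ℕ → ℕ → ℕ
check D n = all (λ w → refuted n w D) (suc (ones n))

nthᵗ : Tm 2
nthᵗ = fstᵗ (rec v0 v1 (sndᵗ v1))

monusᵗ : Tm 2
monusᵗ = rec v1 v0 (predᵗ v1)

prefixᵗ : Tm 2
prefixᵗ = ifz (call monusᵗ (fstᵗ v1 ∷ᵛ v0 ∷ᵛ []ᵛ)) (lit 0)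
              (sucᵗ (ifz (call nthᵗ (v0 ∷ᵛ sndᵗ v1 ∷ᵛ []ᵛ)) (lit 0) (lit 1)))

missAtᵗ : Tm 3
missAtᵗ = case v2 (lit 1)
  (call flagᵗ (call (runᵗ prefixᵗ) (v2 ∷ᵛ evᵗ v0 v0 (lit 0) ∷ᵛ (v2 ,ᵗ v3) ∷ᵛ []ᵛ) ∷ᵛ []ᵛ))

someᵗ : Tm 4
someᵗ = rec v0 (lit 1)
  (ifz v1 (lit 0) (call missAtᵗ (v3 ∷ᵛ v4 ∷ᵛ call nthᵗ (v0 ∷ᵛ v5 ∷ᵛ []ᵛ) ∷ᵛ []ᵛ)))

allᵗ : Tm 3
allᵗ = rec v0 (lit 0) (ifz v1 (call someᵗ (sucᵗ v3 ∷ᵛ v3 ∷ᵛ v0 ∷ᵛ v4 ∷ᵛ []ᵛ)) (lit 1))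

onesᵗ : Tm 1
onesᵗ = rec v0 (lit 0) (flat (lit 1 ,ᵗ v1))

checkᵗ : Tm 2
checkᵗ = call allᵗ (sucᵗ (call onesᵗ (v1 ∷ᵛ []ᵛ)) ∷ᵛ v1 ∷ᵛ v0 ∷ᵛ []ᵛ)

module _ {χ : ℕ → ℕ} where
  eval-nth : ∀ i w → eval χ nthᵗ (leaf i ∷ᵛ leaf w ∷ᵛ []ᵛ) ≡ leaf (nth i w)
  eval-nth zero    w = refl
  eval-nth (suc i) w = trans (cong fstV (shift i w)) (eval-nth i (π₂ w))
    where
    shift : ∀ i w → natrec (leaf w) (λ _ r → sndV r) (suc i) ≡ natrec (leaf (π₂ w)) (λ _ r → sndV r) i
    shift zero    w = refl
    shift (suc i) w = cong sndV (shift i w)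

  eval-monus : ∀ n i → eval χ monusᵗ (leaf n ∷ᵛ leaf i ∷ᵛ []ᵛ) ≡ leaf (n ∸ i)
  eval-monus n zero    = refl
  eval-monus n (suc i) =
    trans (cong (λ v → natrec (leaf 0) (λ i _ → leaf i) (num v)) (eval-monus n i))
          (trans (eval-pred (n ∸ i)) (cong leaf (pred[m∸n]≡m∸[1+n] n i)))
    where
    eval-pred : ∀ m → natrec (leaf 0) (λ i _ → leaf i) m ≡ leaf (pred m)
    eval-pred zero    = refl
    eval-pred (suc m) = refl

  eval-prefix : ∀ n w i → num (eval χ prefixᵗ (leaf i ∷ᵛ node (leaf n) (leaf w) ∷ᵛ []ᵛ)) ≡ prefix n w i
  eval-prefix n w i
    rewrite eval-monus n i | eval-nth i w
          | eval-if0 (nth i w) 0 1 =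
    cong num (trans (eval-if0 (n ∸ i) 0 _) (cong (λ b → leaf (if0 (n ∸ i) 0 (suc b))) (digit (nth i w))))
    where
    digit : ∀ a → if0 a 0 1 ≡ bit (positive a)
    digit zero    = refl
    digit (suc a) = refl

  eval-missAt : ∀ n w a → eval χ missAtᵗ (leaf n ∷ᵛ leaf w ∷ᵛ leaf a ∷ᵛ []ᵛ) ≡ leaf (missAt n w a)
  eval-missAt n w zero    = refl
  eval-missAt n w (suc e) =
    trans (cong (λ s → eval χ flagᵗ (s ∷ᵛ []ᵛ))
                (eval-run prefixᵗ {χ} {prefix n w} {node (leaf n) (leaf w)} (eval-prefix n w) n (init e e)))
          (eval-flag {χ} (trial n w e))

  eval-some : ∀ n w D k → eval χ someᵗ (leaf k ∷ᵛ leaf n ∷ᵛ leaf w ∷ᵛ leaf D ∷ᵛ []ᵛ) ≡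
              leaf (some (miss n w D) k)
  eval-some n w D zero    = refl
  eval-some n w D (suc k) =
    trans (cong₂ (λ r v → natrec (leaf 0) (λ _ _ → v) (num r)) (eval-some n w D k)
            (trans (cong (λ a → eval χ missAtᵗ (leaf n ∷ᵛ leaf w ∷ᵛ a ∷ᵛ []ᵛ)) (eval-nth k D))
                   (eval-missAt n w (nth k D))))
          (eval-if0 (some (miss n w D) k) 0 (miss n w D k))

  eval-all : ∀ n D k → eval χ allᵗ (leaf k ∷ᵛ leaf n ∷ᵛ leaf D ∷ᵛ []ᵛ) ≡
             leaf (all (λ w → refuted n w D) k)
  eval-all n D zero    = refl
  eval-all n D (suc k) =
    trans (cong₂ (λ r v → natrec v (λ _ _ → leaf 1) (num r)) (eval-all n D k) (eval-some n k D (suc n)))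
          (eval-if0 (all (λ w → refuted n w D) k) (refuted n k D) 1)

  eval-ones : ∀ n → eval χ onesᵗ (leaf n ∷ᵛ []ᵛ) ≡ leaf (ones n)
  eval-ones zero    = refl
  eval-ones (suc n) = cong (λ v → leaf (pair 1 (num v))) (eval-ones n)

  eval-check : ∀ D n → eval χ checkᵗ (leaf D ∷ᵛ leaf n ∷ᵛ []ᵛ) ≡ leaf (check D n)
  eval-check D n =
    trans (cong (λ v → eval χ allᵗ (leaf (suc (num v)) ∷ᵛ leaf n ∷ᵛ leaf D ∷ᵛ []ᵛ)) (eval-ones n))
          (eval-all n D (suc (ones n)))

-- Deciding refutability with the halting problem

⟦⟧⇒Φ : ∀ Y c x y → ⟦ c ⟧ Y x y → Φ Y ⌜ c ⌝ x y
⟦⟧⇒Φ Y c x y = subst (λ c → ⟦ c ⟧ Y x y) (sym (decode-⌜⌝ c))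

constant : ℕ → ℕ
constant zero    = pair 0 0
constant (suc n) = pair 6 (pair (pair 1 0) (constant n))

decode-constant : ∀ n → decode (constant n) ≡ constC n
decode-constant zero    = decode-pair 0 0
decode-constant (suc n) =
  trans (decode-Comp (pair 1 0) (constant n)) (cong₂ Comp (decode-pair 1 0) (decode-constant n))

constantᵗ : Tm 1
constantᵗ = rec v0 (lit 0 ,ᵗ lit 0) (lit 6 ,ᵗ (lit 1 ,ᵗ lit 0) ,ᵗ v1)

eval-constant : ∀ {χ} n → num (eval χ constantᵗ (leaf n ∷ᵛ []ᵛ)) ≡ constant n
eval-constant zero    = refl
eval-constant {χ} (suc n) = cong (λ m → pair 6 (pair (pair 1 0) m)) (eval-constant {χ} n)

-- By compactness, this says that no oracle makes all programs listed in D
-- diverge on themselves.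
Refuted : ℕ → Set
Refuted D = ∃[ n ] check D n ≡ 0

check-correct : ∀ D n → ⟦ code₂ checkᵗ ⟧ ∅ ⟨ D , n ⟩ (check D n)
check-correct D n = subst (⟦ code₂ checkᵗ ⟧ ∅ ⟨ D , n ⟩) (cong num (eval-check {λ _ → 0} D n))
  (code₂-correct 0-char-∅ checkᵗ D n)

opaque
  refuter : Code
  refuter = Mu (code₂ checkᵗ)

  refuter-complete : ∀ D → Refuted D → ∃[ y ] ⟦ refuter ⟧ ∅ D y
  refuter-complete D (n , h) = Mu-search ∅ (code₂ checkᵗ) D (check D) (check-correct D) n h

  refuter-sound : ∀ D y → ⟦ refuter ⟧ ∅ D y → Refuted D
  refuter-sound D y p = y , Mu-result ∅ (code₂ checkᵗ) D (check D) (check-correct D) p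

Comp-constC⁻¹ : ∀ c n Y x y → ⟦ Comp c (constC n) ⟧ Y x y → ⟦ c ⟧ Y n y
Comp-constC⁻¹ c n Y x y (n′ , p , q) =
  subst (λ n → ⟦ c ⟧ Y n y) (⟦⟧-functional (constC n) Y x p (constC-correct Y n x)) q

-- The program ignores its input, so whether it halts on its own number is whether the refuter halts
-- on `D`. In this way `∅ ′` decides `Refuted`.
refuterAt : ℕ → ℕ
refuterAt D = pair 6 (pair ⌜ refuter ⌝ (constant D))

refuterAtᵗ : Tm 1
refuterAtᵗ = lit 6 ,ᵗ lit ⌜ refuter ⌝ ,ᵗ call constantᵗ (v0 ∷ᵛ []ᵛ)

eval-refuterAt : ∀ {χ} D → num (eval χ refuterAtᵗ (leaf D ∷ᵛ []ᵛ)) ≡ refuterAt D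
eval-refuterAt {χ} D = cong (λ m → pair 6 (pair ⌜ refuter ⌝ m)) (eval-constant {χ} D)

decode-refuterAt : ∀ D → decode (refuterAt D) ≡ Comp refuter (constC D)
decode-refuterAt D =
  trans (decode-Comp _ _) (cong₂ Comp (decode-⌜⌝ refuter) (decode-constant D))

Refuted⇒∅′ : ∀ D → Refuted D → refuterAt D ∈ ∅ ′
Refuted⇒∅′ D r =
  let y , p = refuter-complete D r in
  y , subst (λ c → ⟦ c ⟧ ∅ (refuterAt D) y) (sym (decode-refuterAt D))
        (D , constC-correct ∅ D (refuterAt D) , p)

∅′⇒Refuted : ∀ D → refuterAt D ∈ ∅ ′ → Refuted D
∅′⇒Refuted D (y , p) = refuter-sound D y
  (Comp-constC⁻¹ refuter D ∅ (refuterAt D) y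
    (subst (λ c → ⟦ c ⟧ ∅ (refuterAt D) y) (decode-refuterAt D) p))

-- The programs that the oracle under construction makes diverge on themselves:
-- v, and then greedily every program below e for which this is possible.  Here χ
-- is meant to be the characteristic function of the halting problem.
module _ (v : ℕ) (χ : ℕ → ℕ) where
  forced : ℕ → ℕ
  forced zero    = pair (suc v) 0
  forced (suc e) = if0 (χ (refuterAt (pair (suc e) (forced e)))) (pair (suc e) (forced e)) (forced e)

askᵗ : Tm 2
askᵗ = ask (call refuterAtᵗ (flat (sucᵗ v0 ,ᵗ v1) ∷ᵛ []ᵛ))

forcedᵗ : ℕ → Tm 1
forcedᵗ v = rec v0 (flat (lit (suc v) ,ᵗ lit 0)) (ifz askᵗ′ (flat (sucᵗ v0 ,ᵗ v1)) v1)
  where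
  askᵗ′ : Tm 3
  askᵗ′ = call askᵗ (v0 ∷ᵛ v1 ∷ᵛ []ᵛ)

-- Membership of e in the jump is settled at stage e: the oracle's answer whether e together with
-- the list forced so far is refuted is already the value sought.
jumpᵗ : ℕ → Tm 1
jumpᵗ v = call askᵗ (v0 ∷ᵛ call (forcedᵗ v) (v0 ∷ᵛ []ᵛ) ∷ᵛ []ᵛ)

module _ {χ : ℕ → ℕ} where
  eval-ask : ∀ e D → eval χ askᵗ (leaf e ∷ᵛ leaf D ∷ᵛ []ᵛ) ≡ leaf (χ (refuterAt (pair (suc e) D)))
  eval-ask e D = cong (λ n → leaf (χ n)) (eval-refuterAt {χ} (pair (suc e) D))

  eval-forced : ∀ v e → eval χ (forcedᵗ v) (leaf e ∷ᵛ []ᵛ) ≡ leaf (forced v χ e)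
  eval-forced v zero    = refl
  eval-forced v (suc e) =
    trans (cong (λ r → natrec (leaf (pair (suc e) (num r))) (λ _ _ → r)
                         (num (eval χ askᵗ (leaf e ∷ᵛ r ∷ᵛ []ᵛ)))) (eval-forced v e))
    (trans (cong (λ a → natrec (leaf (pair (suc e) (forced v χ e))) (λ _ _ → leaf (forced v χ e)) (num a))
                 (eval-ask e (forced v χ e)))
           (eval-if0 (χ (refuterAt (pair (suc e) (forced v χ e))))
                     (pair (suc e) (forced v χ e)) (forced v χ e)))

  eval-jump : ∀ v e → eval χ (jumpᵗ v) (leaf e ∷ᵛ []ᵛ) ≡ leaf (χ (refuterAt (pair (suc e) (forced v χ e))))
  eval-jump v e = trans (cong (λ D → eval χ askᵗ (leaf e ∷ᵛ D ∷ᵛ []ᵛ)) (eval-forced v e))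
                        (eval-ask e (forced v χ e))

-- The low basis theorem

⌊_⌋ : (ℕ → Bool) → Pred ℕ 0ℓ
⌊ b ⌋ i = b i ≡ true

⌊⌋-char : ∀ b → Char ⌊ b ⌋ (λ i → bit (b i))
⌊⌋-char b i with b i
... | true  = inj₁ (refl , refl)
... | false = inj₂ ((λ ()) , refl)

prefix-sound : ∀ Y (b : ℕ → Bool) → Char Y (λ i → bit (b i)) → ∀ n w →
               (∀ i → i < n → positive (nth i w) ≡ b i) →
               ∀ i c → prefix n w i ≡ suc c → ⟦ Oracle ⟧ Y i c
prefix-sound Y b Yb n w agree i c h with i<n , refl ← prefix-known n w i h =
  subst (⟦ Oracle ⟧ Y i) (cong bit (sym (agree i i<n))) (Yb i)

trial-sound : ∀ Y (b : ℕ → Bool) → Char Y (λ i → bit (b i)) → ∀ n w →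
              (∀ i → i < n → positive (nth i w) ≡ b i) →
              ∀ e → flag (trial n w e) ≡ 0 → e ∈ Y ′
trial-sound Y b Yb n w agree e h =
  _ , Within-⟦⟧ {n} (decode e) {Y} {e}
        (run-sound (prefix n w) Y (prefix-sound Y b Yb n w agree) n {e} {e} (flag-0 (trial n w e) h))

⌊⌋-answers : ∀ b i c → ⟦ Oracle ⟧ ⌊ b ⌋ i c → suc (bit (b i)) ≡ suc c
⌊⌋-answers b i c q = cong suc (⟦⟧-functional Oracle ⌊ b ⌋ i (⌊⌋-char b i) q)

-- A halting computation takes finitely many steps and reads finitely many bits. Agreement is
-- demanded only below l, while the trial may use a longer prefix, because the path constructed
-- below agrees with good prefixes only on an initial part.
trial-complete : ∀ b e → e ∈ ⌊ b ⌋ ′ → ∃[ l ] (∀ n w → l ≤ n →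
                 (∀ i → i < l → positive (nth i w) ≡ b i) → flag (trial n w e) ≡ 0)
trial-complete b e (y , p)
  with t , h ← run-complete (λ i → suc (bit (b i))) ⌊ b ⌋ (⌊⌋-answers b) {e} {e} {y} p
  with N , u ← use (λ i → suc (bit (b i))) t (init e e) =
  N ⊔ t , λ n w l≤n agree →
    cong flag (run-stays (prefix n w) (≤-trans (m≤n⊔m N t) l≤n)
      (trans (u (prefix n w) λ i i<N →
                trans (prefix-< w (<-≤-trans i<N (≤-trans (m≤m⊔n N t) l≤n)))
                      (cong (λ β → suc (bit β)) (agree i (<-≤-trans i<N (m≤m⊔n N t)))))
             h))

missAt-0 : ∀ n w a → missAt n w a ≡ 0 → ∃[ e ] (a ≡ suc e × flag (trial n w e) ≡ 0)
missAt-0 n w (suc e) h = e , refl , h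

module _ (em : ExcludedMiddle 0ℓ) where

  characteristic : ∀ (Y : Pred ℕ 0ℓ) → ∃[ b ] Char Y (λ i → bit (b i))
  characteristic Y = (λ i → proj₁ (decide i)) , λ i → proj₂ (decide i)
    where
    decide : ∀ i → ∃[ b ] ⟦ Oracle ⟧ Y i (bit b)
    decide i with em {Y i}
    ... | yes p = true , inj₁ (p , refl)
    ... | no ¬p = false , inj₂ (¬p , refl)

  -- Weak König's lemma. `Good` need not be closed under restriction, so the extendability of a
  -- finite sequence is expressed by `Cofinal`: good prefixes with these first digits exist for
  -- arbitrarily large n.
  module König (Good : ℕ → ℕ → Set) (good : ∀ n → ∃[ w ] Good n w) where
    Cofinal : (ℕ → Set) → Set
    Cofinal C = ∀ m → ∃[ n ] ∃[ w ] (m ≤ n × Good n w × C w)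

    -- If the digit `true` is not cofinal, then it does not occur from some `m₀` on, and every later
    -- witness has the digit `false`.
    extend : ∀ {C} → Cofinal C → ∀ l → ∃[ β ] Cofinal (λ w → C w × positive (nth l w) ≡ β)
    extend {C} cof l with em {Cofinal (λ w → C w × positive (nth l w) ≡ true)}
    ... | yes p = true , p
    ... | no ¬p with em {∃[ m ] (¬ (∃[ n ] ∃[ w ] (m ≤ n × Good n w × C w × positive (nth l w) ≡ true)))}
    ...   | no ¬q = ⊥-elim (¬p λ m → stable m)
      where
      stable : ∀ m → ∃[ n ] ∃[ w ] (m ≤ n × Good n w × C w × positive (nth l w) ≡ true)
      stable m with em {∃[ n ] ∃[ w ] (m ≤ n × Good n w × C w × positive (nth l w) ≡ true)}
      ... | yes r = r
      ... | no ¬r = ⊥-elim (¬q (m , ¬r))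
    ...   | yes (m₀ , never) = false , λ m →
      let n , w , m≤n , g , c = cof (m ⊔ m₀) in
      n , w , ≤-trans (m≤m⊔n m m₀) m≤n , g , c ,
      is-false (λ e → never (n , w , ≤-trans (m≤n⊔m m m₀) m≤n , g , c , e))
      where
      is-false : ∀ {β} → ¬ (β ≡ true) → β ≡ false
      is-false {false} _ = refl
      is-false {true}  h = ⊥-elim (h refl)

    stage : ℕ → Σ[ C ∈ (ℕ → Set) ] Cofinal C
    stage zero    = (λ _ → ⊤) , λ m → m , proj₁ (good m) , ≤-refl , proj₂ (good m) , tt
    stage (suc l) with C , cof ← stage l with β , cof′ ← extend cof l =
      (λ w → C w × positive (nth l w) ≡ β) , cof′

    path : ℕ → Bool
    path l = proj₁ (extend (proj₂ (stage l)) l)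

    stage-path : ∀ l {w} → proj₁ (stage l) w → ∀ i → i < l → positive (nth i w) ≡ path i
    stage-path (suc l) (c , e) i (s≤s i≤l) with m≤n⇒m<n∨m≡n i≤l
    ... | inj₁ i<l  = stage-path l c i i<l
    ... | inj₂ refl = e

    path-good : ∀ l → ∃[ n ] ∃[ w ] (l ≤ n × Good n w × (∀ i → i < l → positive (nth i w) ≡ path i))
    path-good l with n , w , l≤n , g , c ← proj₂ (stage l) l = n , w , l≤n , g , stage-path l c

  -- No list `D e` is refuted, so a single path makes all listed programs diverge. A program that
  -- was not added is refuted together with earlier ones; as those diverge, it halts. Hence the
  -- stages decide the jump of the path.
  low-basis : ∀ v → Σ[ X ∈ Pred ℕ 0ℓ ] v ∉ X ′ → Σ[ Y ∈ Pred ℕ 0ℓ ] (Low Y × v ∉ Y ′)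
  low-basis v (X , v∉X′) = ⌊ path ⌋ , (⌜ code₁ (jumpᵗ v) ⌝ , low) , survives 0 0 v (nth-zero _ _)
    where
    χ : ℕ → ℕ
    χ i = bit (proj₁ (characteristic (∅ ′)) i)

    χ-char : Char (∅ ′) χ
    χ-char = proj₂ (characteristic (∅ ′))

    D : ℕ → ℕ
    D = forced v χ

    χ-Refuted : ∀ E → χ (refuterAt E) ≡ 1 × Refuted E ⊎ χ (refuterAt E) ≡ 0 × ¬ Refuted E
    χ-Refuted E with χ-char (refuterAt E)
    ... | inj₁ (p , e) = inj₁ (e , ∅′⇒Refuted E p)
    ... | inj₂ (p , e) = inj₂ (e , λ r → p (Refuted⇒∅′ E r))

    D-stage : ∀ e → (Refuted (pair (suc e) (D e)) × D (suc e) ≡ D e)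
                  ⊎ (¬ Refuted (pair (suc e) (D e)) × D (suc e) ≡ pair (suc e) (D e))
    D-stage e with χ (refuterAt (pair (suc e) (D e))) | χ-Refuted (pair (suc e) (D e))
    ... | .1 | inj₁ (refl , r) = inj₁ (r , refl)
    ... | .0 | inj₂ (refl , r) = inj₂ (r , refl)

    only-v : ∀ i e → nth i (D 0) ≡ suc e → e ≡ v
    only-v zero    e h = suc-injective (trans (sym h) (nth-zero _ _))
    only-v (suc i) e h with () ← trans (sym (trans (nth-suc i _ _) (nth-0 i))) h

    unrefuted : ∀ e → ¬ Refuted (D e)
    -- The digits of `X` form one of the prefixes that a refutation must handle, and it would make v
    -- halt with oracle `X`.
    unrefuted zero (n , h)
      with b , Xb ← characteristic X
      with w , w≤ , agree ← digits b n
      with i , _ , m ← some-elim (miss n w (D 0)) (suc n) (all-elim (λ w → refuted n w (D 0)) h (s≤s w≤))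
      with e , listed , halts ← missAt-0 n w (nth i (D 0)) m
      with refl ← only-v i e listed = v∉X′ (trial-sound X b Xb n w agree e halts)
    unrefuted (suc e) with D-stage e
    ... | inj₁ (_ , eq) = subst (λ E → ¬ Refuted E) (sym eq) (unrefuted e)
    ... | inj₂ (r , eq) = subst (λ E → ¬ Refuted E) (sym eq) r

    -- The same n serves as stage, prefix length and number of steps, so that one path treats the
    -- lists of all stages at once.
    Good : ℕ → ℕ → Set
    Good n w = refuted n w (D n) ≢ 0

    good : ∀ n → ∃[ w ] Good n w
    good n with em {∃[ w ] Good n w}
    ... | yes p = p
    ... | no ¬p = ⊥-elim (unrefuted n
      (n , all-intro (λ w → refuted n w (D n)) (suc (ones n)) λ w _ → is-0 w))
      where
      is-0 : ∀ w → refuted n w (D n) ≡ 0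
      is-0 w with refuted n w (D n) in eq
      ... | zero  = refl
      ... | suc _ = ⊥-elim (¬p (w , λ e → 1+n≢0 (trans (sym eq) e)))

    open König Good good

    -- A stage adds at most one entry, at the front. All entries of `D n` thus lie within the
    -- `suc n` positions that `refuted` inspects.
    position : ∀ n i e → nth i (D n) ≡ suc e → i ≤ n
    position zero    zero    e h = z≤n
    position zero    (suc i) e h with () ← trans (sym (trans (nth-suc i _ _) (nth-0 i))) h
    position (suc n) i e h with D-stage n
    ... | inj₁ (_ , eq) = m≤n⇒m≤1+n (position n i e (subst (λ E → nth i E ≡ suc e) eq h))
    position (suc n) zero    e h | inj₂ (_ , eq) = z≤n
    position (suc n) (suc i) e h | inj₂ (_ , eq) =
      s≤s (position n i e (trans (sym (nth-suc i _ _)) (subst (λ E → nth (suc i) E ≡ suc e) eq h)))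

    persists : ∀ k m i e → nth i (D m) ≡ suc e → ∃[ j ] nth j (D (k + m)) ≡ suc e
    persists zero    m i e h = i , h
    persists (suc k) m i e h with j , h′ ← persists k m i e h | D-stage (k + m)
    ... | inj₁ (_ , eq) = j , subst (λ E → nth j E ≡ suc e) (sym eq) h′
    ... | inj₂ (_ , eq) = suc j , subst (λ E → nth (suc j) E ≡ suc e) (sym eq) (trans (nth-suc j _ _) h′)

    -- Were e to halt on the path, every sufficiently long prefix with the right initial digits
    -- would show it. A good prefix of this sort exists at a stage n past m, where e is still
    -- listed, contradicting its goodness.
    survives : ∀ m i e → nth i (D m) ≡ suc e → e ∉ ⌊ path ⌋ ′
    survives m i e h e∈ =
      let l , halts = trial-complete path e e∈
          n , w , l⊔m≤n , g , agree = path-good (l ⊔ m)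
          l≤n = ≤-trans (m≤m⊔n l m) l⊔m≤n
          m≤n = ≤-trans (m≤n⊔m l m) l⊔m≤n
          j , listed = persists (n ∸ m) m i e h
          listed′ = subst (λ n → nth j (D n) ≡ suc e) (m∸n+n≡m m≤n) listed
      in g (some-intro (miss n w (D n)) (s≤s (position n j e listed′))
             (trans (cong (missAt n w) listed′)
                    (halts n w l≤n λ i i<l → agree i (<-≤-trans i<l (m≤m⊔n l m)))))

    jump : ∀ e → (e ∈ ⌊ path ⌋ ′ × χ (refuterAt (pair (suc e) (D e))) ≡ 1)
               ⊎ (e ∉ ⌊ path ⌋ ′ × χ (refuterAt (pair (suc e) (D e))) ≡ 0)
    jump e with χ-Refuted (pair (suc e) (D e))
    ... | inj₁ (χ≡1 , n , h) = inj₁ (halting , χ≡1)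
      where
      halting : e ∈ ⌊ path ⌋ ′
      halting
        with w , w≤ , agree ← digits path n
        with i , _ , m ← some-elim (miss n w (pair (suc e) (D e))) (suc n)
               (all-elim (λ w → refuted n w (pair (suc e) (D e))) h (s≤s w≤))
        with e′ , listed , halts ← missAt-0 n w (nth i (pair (suc e) (D e))) m
        with i
      -- Position 0 holds e itself; the later positions are those of `D e`, whose programs diverge
      -- on the path.
      ... | zero  = subst (_∈ ⌊ path ⌋ ′) (suc-injective (trans (sym listed) (nth-zero _ _)))
                      (trial-sound ⌊ path ⌋ path (⌊⌋-char path) n w agree e′ halts)
      ... | suc i = ⊥-elim (survives e i e′ (trans (sym (nth-suc i _ _)) listed)
                      (trial-sound ⌊ path ⌋ path (⌊⌋-char path) n w agree e′ halts))
    ... | inj₂ (χ≡0 , r) = inj₂ (diverging , χ≡0)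
      where
      diverging : e ∉ ⌊ path ⌋ ′
      diverging with D-stage e
      ... | inj₁ (r′ , _)  = ⊥-elim (r r′)
      ... | inj₂ (_ , eq) = survives (suc e) 0 e (trans (cong (nth 0) eq) (nth-zero _ _))

    jump-correct : ∀ e → Φ (∅ ′) ⌜ code₁ (jumpᵗ v) ⌝ e (χ (refuterAt (pair (suc e) (D e))))
    jump-correct e = ⟦⟧⇒Φ (∅ ′) (code₁ (jumpᵗ v)) e (χ (refuterAt (pair (suc e) (D e))))
      (subst (⟦ code₁ (jumpᵗ v) ⟧ (∅ ′) e) (cong num (eval-jump {χ} v e))
             (code₁-correct {∅ ′} {χ} χ-char (jumpᵗ v) e))

    low : ∀ e → (e ∈ ⌊ path ⌋ ′ → Φ (∅ ′) ⌜ code₁ (jumpᵗ v) ⌝ e 1)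
              × (e ∉ ⌊ path ⌋ ′ → Φ (∅ ′) ⌜ code₁ (jumpᵗ v) ⌝ e 0)
    low e with jump e
    ... | inj₁ (p , eq)  =
      (λ _ → subst (Φ (∅ ′) ⌜ code₁ (jumpᵗ v) ⌝ e) eq (jump-correct e)) , λ ¬p → ⊥-elim (¬p p)
    ... | inj₂ (¬p , eq) =
      (λ p → ⊥-elim (¬p p)) , λ _ → subst (Φ (∅ ′) ⌜ code₁ (jumpᵗ v) ⌝ e) eq (jump-correct e)

-- Combinators of K₁

-- Decoding ignores the payload of Fst, so an index can carry a label.
labelled : ℕ → ℕ → ℕ
labelled e δ = pair 6 (pair e (pair 5 (pair (pair 2 δ) (pair 3 0))))

label : ℕ → ℕ
label n = π₂ (π₁ (π₂ (π₂ (π₂ n))))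

label-labelled : ∀ e δ → label (labelled e δ) ≡ δ
label-labelled e δ = begin
  π₂ (π₁ (π₂ (π₂ (π₂ (labelled e δ)))))        ≡⟨ cong (λ n → π₂ (π₁ (π₂ (π₂ n)))) (π₂-pair 6 _) ⟩
  π₂ (π₁ (π₂ (π₂ (pair e (pair 5 p)))))         ≡⟨ cong (λ n → π₂ (π₁ (π₂ n))) (π₂-pair e _) ⟩
  π₂ (π₁ (π₂ (pair 5 p)))                       ≡⟨ cong (λ n → π₂ (π₁ n)) (π₂-pair 5 p) ⟩
  π₂ (π₁ p)                                     ≡⟨ cong π₂ (π₁-pair (pair 2 δ) (pair 3 0)) ⟩
  π₂ (pair 2 δ)                                 ≡⟨ π₂-pair 2 δ ⟩
  δ                                             ∎
  where
  open ≡-Reasoning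
  p = pair (pair 2 δ) (pair 3 0)

decode-labelled : ∀ e δ → decode (labelled e δ) ≡ Comp (decode e) Id
decode-labelled e δ = trans (decode-Comp e _) (cong (Comp (decode e))
  (trans (decode-Pair (pair 2 δ) (pair 3 0)) (cong₂ Pair (decode-pair 2 δ) (decode-pair 3 0))))

φ-labelled : ∀ e δ x y → φ e x y → φ (labelled e δ) x y
φ-labelled e δ x y p = subst (λ c → ⟦ c ⟧ ∅ x y) (sym (decode-labelled e δ)) (x , Id-correct ∅ x , p)

labelledᵗ : ∀ {n} → Tm n → Tm n → Tm n
labelledᵗ e δ = lit 6 ,ᵗ e ,ᵗ lit 5 ,ᵗ (lit 2 ,ᵗ δ) ,ᵗ (lit 3 ,ᵗ lit 0)

data Kind : Set where
  𝐤 𝐬    : Kind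
  𝐤₁ 𝐬₁ : ℕ → Kind
  𝐬₂     : ℕ → ℕ → Kind

describe : Kind → ℕ
describe 𝐤        = pair 0 (pair 0 0)
describe 𝐬        = pair 1 (pair 0 0)
describe (𝐤₁ a)   = pair 2 (pair a 0)
describe (𝐬₁ a)   = pair 3 (pair a 0)
describe (𝐬₂ a b) = pair 4 (pair a b)

kindOf : ℕ → Kind
kindOf δ = byTag (π₁ δ) (π₁ (π₂ δ)) (π₂ (π₂ δ))
  module KindOf where
  byTag : ℕ → ℕ → ℕ → Kind
  byTag 0 a b = 𝐤
  byTag 1 a b = 𝐬
  byTag 2 a b = 𝐤₁ a
  byTag 3 a b = 𝐬₁ a
  byTag _ a b = 𝐬₂ a b

kindOf-describe : ∀ κ → kindOf (describe κ) ≡ κ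
kindOf-describe = λ where
    𝐤        → kindOf-pair 0 0 0
    𝐬        → kindOf-pair 1 0 0
    (𝐤₁ a)   → kindOf-pair 2 a 0
    (𝐬₁ a)   → kindOf-pair 3 a 0
    (𝐬₂ a b) → kindOf-pair 4 a b
  where
  kindOf-pair : ∀ t a b → kindOf (pair t (pair a b)) ≡ KindOf.byTag 0 t a b
  kindOf-pair t a b rewrite π₁-pair t (pair a b) | π₂-pair t (pair a b) | π₁-pair a b | π₂-pair a b = refl

code₁-∅ : ∀ t {x y} → num (eval (λ _ → 0) t (leaf x ∷ᵛ []ᵛ)) ≡ y → ⟦ code₁ t ⟧ ∅ x y
code₁-∅ t {x} h = subst (⟦ code₁ t ⟧ ∅ x) h (code₁-correct {∅} {λ _ → 0} 0-char-∅ t x)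

-- The label is part of what these programs output, so their values are exactly the indices that
-- `kind` recognises. The input of `s₂ᵗ` is a pair ⟨ a , b ⟩, used whole both as the payload of a
-- `Pair` and inside the label.
kᵗ s₂ᵗ : Tm 1
kᵗ  = labelledᵗ (call constantᵗ (v0 ∷ᵛ []ᵛ)) (lit 2 ,ᵗ v0 ,ᵗ lit 0)
s₂ᵗ = labelledᵗ (lit 6 ,ᵗ lit ⌜ universal ⌝ ,ᵗ lit 5 ,ᵗ v0) (lit 4 ,ᵗ v0)

sᵗ : ℕ → Tm 1
sᵗ e = labelledᵗ (lit 6 ,ᵗ lit e ,ᵗ lit 5 ,ᵗ call constantᵗ (v0 ∷ᵛ []ᵛ) ,ᵗ lit ⌜ Id ⌝)
                 (lit 3 ,ᵗ v0 ,ᵗ lit 0)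

opaque
  kC s₂C sC : Code
  kC  = code₁ kᵗ
  s₂C = code₁ s₂ᵗ
  sC  = code₁ (sᵗ ⌜ s₂C ⌝)

program : Kind → ℕ
program 𝐤        = ⌜ kC ⌝
program 𝐬        = ⌜ sC ⌝
program (𝐤₁ a)   = constant a
program (𝐬₁ a)   = pair 6 (pair ⌜ s₂C ⌝ (pair 5 (pair (constant a) ⌜ Id ⌝)))
program (𝐬₂ a b) = pair 6 (pair ⌜ universal ⌝ (pair 5 (pair a b)))

index : Kind → ℕ
index κ = labelled (program κ) (describe κ)

-- Any number has a `label`, possibly a meaningless one. Rebuilding the index from it and comparing
-- excludes all numbers that are not some `index κ`.
kind : ℕ → Maybe Kind
kind n with index (kindOf (label n)) ≟ n
... | yes _ = just (kindOf (label n))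
... | no  _ = nothing

kindOf-index : ∀ κ → kindOf (label (index κ)) ≡ κ
kindOf-index κ = trans (cong kindOf (label-labelled (program κ) (describe κ))) (kindOf-describe κ)

kind-index : ∀ κ → kind (index κ) ≡ just κ
kind-index κ with index (kindOf (label (index κ))) ≟ index κ
... | yes _ = cong just (kindOf-index κ)
... | no ¬p = ⊥-elim (¬p (cong index (kindOf-index κ)))

index-kind : ∀ n {κ} → kind n ≡ just κ → n ≡ index κ
index-kind n h with index (kindOf (label n)) ≟ n
index-kind n refl | yes p = sym p

k₀ s₀ : ℕ
k₀ = index 𝐤
s₀ = index 𝐬

opaque
  unfolding kC
  kC-correct : ∀ a → ⟦ kC ⟧ ∅ a (index (𝐤₁ a))
  kC-correct a = code₁-∅ kᵗ (cong (λ n → labelled n (describe (𝐤₁ a))) (eval-constant {λ _ → 0} a))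

  sC-correct : ∀ a → ⟦ sC ⟧ ∅ a (index (𝐬₁ a))
  sC-correct a = code₁-∅ (sᵗ ⌜ s₂C ⌝)
    (cong (λ n → labelled (pair 6 (pair ⌜ s₂C ⌝ (pair 5 (pair n ⌜ Id ⌝)))) (describe (𝐬₁ a)))
          (eval-constant {λ _ → 0} a))

  s₂C-correct : ∀ a b → ⟦ s₂C ⟧ ∅ ⟨ a , b ⟩ (index (𝐬₂ a b))
  s₂C-correct a b = code₁-∅ s₂ᵗ
    (cong (λ n → labelled (pair 6 (pair ⌜ universal ⌝ (pair 5 n))) (pair 4 n)) (sym (pair-def a b)))

φ-k : ∀ a → φ k₀ a (index (𝐤₁ a))
φ-k a = φ-labelled (program 𝐤) _ a (index (𝐤₁ a)) (⟦⟧⇒Φ ∅ kC a (index (𝐤₁ a)) (kC-correct a))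

φ-k₁ : ∀ a b → φ (index (𝐤₁ a)) b a
φ-k₁ a b = φ-labelled (program (𝐤₁ a)) _ b a
  (subst (λ c → ⟦ c ⟧ ∅ b a) (sym (decode-constant a)) (constC-correct ∅ a b))

φ-s : ∀ a → φ s₀ a (index (𝐬₁ a))
φ-s a = φ-labelled (program 𝐬) _ a (index (𝐬₁ a)) (⟦⟧⇒Φ ∅ sC a (index (𝐬₁ a)) (sC-correct a))

φ-Comp-Pair : ∀ e e₁ e₂ x {p q y} → φ e₁ x p → φ e₂ x q → φ e ⟨ p , q ⟩ y →
              φ (pair 6 (pair e (pair 5 (pair e₁ e₂)))) x y
φ-Comp-Pair e e₁ e₂ x {p} {q} {y} h₁ h₂ h =
  subst (λ c → ⟦ c ⟧ ∅ x y)
    (sym (trans (decode-Comp e (pair 5 (pair e₁ e₂))) (cong (Comp (decode e)) (decode-Pair e₁ e₂))))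
    (⟨ p , q ⟩ , (p , q , h₁ , h₂ , refl) , h)

φ-s₁ : ∀ a b → φ (index (𝐬₁ a)) b (index (𝐬₂ a b))
φ-s₁ a b = φ-labelled (program (𝐬₁ a)) _ b (index (𝐬₂ a b))
  (φ-Comp-Pair ⌜ s₂C ⌝ (constant a) ⌜ Id ⌝ b
    (subst (λ c → ⟦ c ⟧ ∅ b a) (sym (decode-constant a)) (constC-correct ∅ a b))
    (⟦⟧⇒Φ ∅ Id b b (Id-correct ∅ b))
    (⟦⟧⇒Φ ∅ s₂C ⟨ a , b ⟩ (index (𝐬₂ a b)) (s₂C-correct a b)))

φ-s₂ : ∀ a b x {p q y} → φ a x p → φ b x q → φ p q y → φ (index (𝐬₂ a b)) x y
φ-s₂ a b x {p} {q} {y} h₁ h₂ h = φ-labelled (program (𝐬₂ a b)) _ x y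
  (φ-Comp-Pair ⌜ universal ⌝ a b x h₁ h₂ (⟦⟧⇒Φ ∅ universal ⟨ p , q ⟩ y (universal-complete {p} {q} {y} h)))

-- The application of p to q is simulated with fewer steps than the bound d,
-- which is what makes s₂-terms well-founded.
φ-s₂⁻¹ : ∀ d a b x y → Within d (decode (index (𝐬₂ a b))) ∅ x y →
         ∃[ p ] ∃[ q ] (Within d (decode a) ∅ x p × Within d (decode b) ∅ x q ×
                        (∃[ t ] (t < d × run∅ t (init p q) ≡ ret y [])))
φ-s₂⁻¹ d a b x y h = unfold (subst (λ c → Within d c ∅ x y) decoded h)
  where
  decoded : decode (index (𝐬₂ a b)) ≡ Comp (Comp universal (Pair (decode a) (decode b))) Id
  decoded = trans (decode-labelled (program (𝐬₂ a b)) (describe (𝐬₂ a b))) (cong (λ c → Comp c Id)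
    (trans (decode-Comp ⌜ universal ⌝ (pair 5 (pair a b)))
           (cong₂ Comp (decode-⌜⌝ universal) (decode-Pair a b))))
  unfold : Within d (Comp (Comp universal (Pair (decode a) (decode b))) Id) ∅ x y → _
  unfold (x′ , i , z , (p , q , h₁ , h₂ , refl) , h)
    with refl ← Within-functional d Id ∅ x (Id-correct ∅ x) i =
      p , q , h₁ , h₂ , universal-sound {d} {p} {q} {y} h

<-pair : ∀ t {a b} → a ≤ b → a < pair (suc t) b
<-pair t {a} {b} a≤b = ≤-<-trans a≤b
  (subst (_< pair (suc t) b) (π₂-pair (suc t) b) (π₂< (pair (suc t) b) t (π₁-pair (suc t) b)))

≤-pairˡ : ∀ a b → a ≤ pair a b
≤-pairˡ a b = subst (_≤ pair a b) (π₁-pair a b) (π₁≤ (pair a b))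

≤-pairʳ : ∀ a b → b ≤ pair a b
≤-pairʳ a b = subst (_≤ pair a b) (π₂-pair a b) (π₂≤ (pair a b))

args<𝐬₂ : ∀ a b → a < index (𝐬₂ a b) × b < index (𝐬₂ a b)
args<𝐬₂ a b = below (≤-pairˡ a b) , below (≤-pairʳ a b)
  where
  below : ∀ {i} → i ≤ pair a b → i < index (𝐬₂ a b)
  below i≤ = <-pair 5 (≤-trans (<⇒≤ (<-pair 5 (≤-trans (<⇒≤ (<-pair 4 i≤)) (≤-pairʳ _ _)))) (≤-pairˡ _ _))

K₁-combinators : ExcludedMiddle 0ℓ → PAS.IsCombinators K₁ k₀ s₀
K₁-combinators em = record
  { ka↓  = λ a → _ , k₀ , a , refl , refl , φ-k a
  ; kab  = λ a b → _ , b , (k₀ , a , refl , refl , φ-k a) , refl , φ-k₁ a b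
  ; sab↓ = λ a b → _ , sab a b
  ; sabc = sabc
  }
  where
  open PAS K₁ using (_⇓_; _≃_; con; _∙_)
  sab : ∀ a b → con s₀ ∙ con a ∙ con b ⇓ index (𝐬₂ a b)
  sab a b = _ , b , (s₀ , a , refl , refl , φ-s a) , refl , φ-s₁ a b
  sabc : ∀ a b c → con s₀ ∙ con a ∙ con b ∙ con c ≃ con a ∙ con c ∙ (con b ∙ con c)
  -- `_≃_` is a disjunction, so definedness of the right-hand side is decided classically.
  sabc a b c with em {∃[ y ] (con a ∙ con c ∙ (con b ∙ con c) ⇓ y)}
  ... | yes (y , h@(p , q , (_ , _ , refl , refl , h₁) , (_ , _ , refl , refl , h₂) , h₃)) =
    inj₂ (y , (_ , c , sab a b , refl , φ-s₂ a b c h₁ h₂ h₃) , h)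
  ... | no ¬p = inj₁ (undefined , ¬p)
    where
    undefined : ¬ (∃[ y ] (con s₀ ∙ con a ∙ con b ∙ con c ⇓ y))
    undefined (y , n , _ , (m , _ , (_ , _ , refl , refl , g₁) , refl , g₂) , refl , g₃) =
      let m≡ = ⟦⟧-functional (decode s₀) ∅ a g₁ (φ-s a)
          n≡ = ⟦⟧-functional (decode (index (𝐬₁ a))) ∅ b (subst (λ m → φ m b n) m≡ g₂) (φ-s₁ a b)
          t , h = φ-run {index (𝐬₂ a b)} {c} {y} (subst (λ n → φ n c y) n≡ g₃)
          p , q , h₁ , h₂ , u , _ , h₃ = φ-s₂⁻¹ t a b c y (run-Within t (index (𝐬₂ a b)) c h)
      in ¬p (y , p , q , (a , c , refl , refl , Within-⟦⟧ {t} (decode a) {∅} {c} {p} h₁) ,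
                 (b , c , refl , refl , Within-⟦⟧ {t} (decode b) {∅} {c} {q} h₂) , run-φ u p q h₃)

-- A graph model

infixr 6 _⇒_
data El : Set where
  at  : ℕ → El
  _⇒_ : List El → El → El

Sub : Set₁
Sub = Pred El 0ℓ

data App (P Q : Sub) (x : El) : Set where
  app : ∀ {F} → P (F ⇒ x) → All Q F → App P Q x

fin : List El → Sub
fin F x = x ∈ˡ F

fin⊆ : ∀ {P : Sub} {F} → All P F → fin F ⊆ P
fin⊆ = All.lookup

App-mono : ∀ {P P′ Q Q′} → P ⊆ P′ → Q ⊆ Q′ → App P Q ⊆ App P′ Q′
App-mono f g (app p q) = app (f p) (All.map g q)

App-cong : ∀ {P P′ Q Q′} → P ≐ P′ → Q ≐ Q′ → App P Q ≐ App P′ Q′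
App-cong (f , f′) (g , g′) = App-mono f g , App-mono f′ g′

-- Continuity of application: membership in a compound application depends on a finite part of each
-- constituent. The variants cover the occurrences of X, Y and Z in `App (App X Z) (App Y Z)`; as Z
-- occurs twice, `App-finiteʳ` joins two finite parts.
App-finiteˡ : ∀ {X P Q x} → App (App X P) Q x → ∃[ F ] (All X F × App (App (fin F) P) Q x)
App-finiteˡ (app (app p q) r) = [ _ ] , p ∷ [] , app (app (here refl) q) r

All-App-finiteˡ : ∀ {Y P G} → All (App Y P) G → ∃[ F ] (All Y F × All (App (fin F) P) G)
All-App-finiteˡ []             = [] , [] , []
All-App-finiteˡ (app p q ∷ rs) with F , s , t ← All-App-finiteˡ rs =
  _ ∷ F , p ∷ s , app (here refl) q ∷ All.map (App-mono there (λ i → i)) t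

All-App-finiteʳ : ∀ {P Z G} → All (App P Z) G → ∃[ H ] (All Z H × All (App P (fin H)) G)
All-App-finiteʳ []                 = [] , [] , []
All-App-finiteʳ (app {H} p q ∷ rs) with H′ , s , t ← All-App-finiteʳ rs =
  H ++ H′ , ++⁺ q s ,
  app p (All.tabulate ∈-++⁺ˡ) ∷ All.map (App-mono (λ i → i) (∈-++⁺ʳ H)) t

App-finiteʳ : ∀ {P Q Z x} → App (App P Z) (App Q Z) x →
              ∃[ H ] (All Z H × App (App P (fin H)) (App Q (fin H)) x)
App-finiteʳ (app (app {H} p q) r) with H′ , s , t ← All-App-finiteʳ r =
  H ++ H′ , ++⁺ q s , app (app p (All.tabulate ∈-++⁺ˡ))
  (All.map (App-mono (λ i → i) (∈-++⁺ʳ H)) t)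

App-finiteᵐ : ∀ {R Y P x} → App R (App Y P) x → ∃[ G ] (All Y G × App R (App (fin G) P) x)
App-finiteᵐ (app r q) with G , s , t ← All-App-finiteˡ q = G , s , app r t

-- The arrows in the denotation of a number n of kind κ.  A number that is not a
-- combinator denotes its graph under φ; for the combinators, the arrows are
-- chosen so that the combinator laws hold for arbitrary sets as arguments.  The
-- atoms at n keep the denotations apart.
data Arrow (M : ℕ → Sub) : Maybe Kind → ℕ → List El → El → Set where
  graph : ∀ {n m c x} → φ n m c → M c x → Arrow M nothing n [ at m ] x
  k-at  : ∀ {n a} → Arrow M (just 𝐤) n [ at a ] (at (index (𝐤₁ a)))
  k-arr : ∀ {n x} → Arrow M (just 𝐤) n [ x ] ([] ⇒ x)
  k₁-ar : ∀ {n a x} → M a x → Arrow M (just (𝐤₁ a)) n [] x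
  s-at  : ∀ {n a} → Arrow M (just 𝐬) n [ at a ] (at (index (𝐬₁ a)))
  -- This accounts for the arrow `s₁-at` in the denotation of `s a`, which `s-arr` cannot produce.
  -- It yields only atoms after two arguments, and atoms contribute nothing to a third application,
  -- so the law of `s` is unaffected.
  s-at₁ : ∀ {n a b} → Arrow M (just 𝐬) n [ at a ] ([ at b ] ⇒ at (index (𝐬₂ a b)))
  s-arr : ∀ {n F G H x} → App (App (fin F) (fin H)) (App (fin G) (fin H)) x →
          Arrow M (just 𝐬) n F (G ⇒ H ⇒ x)
  s₁-at : ∀ {n a b} → Arrow M (just (𝐬₁ a)) n [ at b ] (at (index (𝐬₂ a b)))
  s₁-ar : ∀ {n a G H x} → App (App (M a) (fin H)) (App (fin G) (fin H)) x →
          Arrow M (just (𝐬₁ a)) n G (H ⇒ x)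
  s₂-ar : ∀ {n a b H x} → App (App (M a) (fin H)) (App (M b) (fin H)) x →
          Arrow M (just (𝐬₂ a b)) n H x

data Mem (n : ℕ) : Sub where
  atom  : Mem n (at n)
  arrow : ∀ {F x} → Arrow Mem (kind n) n F x → Mem n (F ⇒ x)

module _ {n κ} (eq : kind n ≡ κ) where
  Mem⇒Arrow : ∀ {F x} → Mem n (F ⇒ x) → Arrow Mem κ n F x
  Mem⇒Arrow (arrow p) = subst (λ κ → Arrow Mem κ n _ _) eq p

  Arrow⇒Mem : ∀ {F x} → Arrow Mem κ n F x → Mem n (F ⇒ x)
  Arrow⇒Mem p = arrow (subst (λ κ → Arrow Mem κ n _ _) (sym eq) p)

at-atom : ∀ {n m} → Mem n (at m) → m ≡ n
at-atom atom = refl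

-- The denotation of m is the only one that contains the atom `at m`, so it activates precisely the
-- graph arrows for the argument m.
graph-law : ∀ {n m c} → kind n ≡ nothing → φ n m c → App (Mem n) (Mem m) ≐ Mem c
graph-law {n} {m} {c} eq h = to , λ p → app (Arrow⇒Mem eq (graph h p)) (atom ∷ [])
  where
  to : App (Mem n) (Mem m) ⊆ Mem c
  to (app p q) with Mem⇒Arrow eq p
  to (app p (q ∷ [])) | graph {m = m′} {c = c′} h′ r with refl ← at-atom q =
    subst (λ c → Mem c _) (⟦⟧-functional (decode n) ∅ m h′ h) r

k₁-law : ∀ {n a Z} → kind n ≡ just (𝐤₁ a) → App (Mem n) Z ≐ Mem a
k₁-law {n} {a} {Z} eq = to , λ p → app (Arrow⇒Mem eq (k₁-ar p)) []
  where
  to : App (Mem n) Z ⊆ Mem a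
  to (app p q) with k₁-ar r ← Mem⇒Arrow eq p = r

k-law : ∀ {n X Y} → kind n ≡ just 𝐤 → App (App (Mem n) X) Y ≐ X
k-law {n} {X} {Y} eq = to , λ p → app (app (Arrow⇒Mem eq k-arr) (p ∷ [])) []
  where
  to : App (App (Mem n) X) Y ⊆ X
  to (app (app p q) r) with Mem⇒Arrow eq p
  to (app (app p (q ∷ [])) r) | k-arr = q

-- The atom of the result comes from `k-at`, its arrows `[] ⇒ x` come from `k-arr`.
k-graph : ∀ {n a} → kind n ≡ just 𝐤 → App (Mem n) (Mem a) ≐ Mem (index (𝐤₁ a))
k-graph {n} {a} eq = to , from
  where
  to : App (Mem n) (Mem a) ⊆ Mem (index (𝐤₁ a))
  to (app p q) with Mem⇒Arrow eq p
  to (app p (q ∷ [])) | k-at with refl ← at-atom q = atom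
  to (app p (q ∷ [])) | k-arr = Arrow⇒Mem (kind-index (𝐤₁ a)) (k₁-ar q)
  from : Mem (index (𝐤₁ a)) ⊆ App (Mem n) (Mem a)
  from atom = app (Arrow⇒Mem eq k-at) (atom ∷ [])
  from p@(arrow _) with k₁-ar q ← Mem⇒Arrow (kind-index (𝐤₁ a)) p =
    app (Arrow⇒Mem eq k-arr) (q ∷ [])

s₂-law : ∀ {n a b Z} → kind n ≡ just (𝐬₂ a b) → App (Mem n) Z ≐ App (App (Mem a) Z) (App (Mem b) Z)
s₂-law {n} {a} {b} {Z} eq = to , from
  where
  to : App (Mem n) Z ⊆ App (App (Mem a) Z) (App (Mem b) Z)
  to (app p q) with s₂-ar r ← Mem⇒Arrow eq p =
    App-mono (App-mono (λ i → i) (fin⊆ q)) (App-mono (λ i → i) (fin⊆ q)) r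
  from : App (App (Mem a) Z) (App (Mem b) Z) ⊆ App (Mem n) Z
  from p with _ , q , r ← App-finiteʳ p = app (Arrow⇒Mem eq (s₂-ar r)) q

s₁-graph : ∀ {n a b} → kind n ≡ just (𝐬₁ a) → App (Mem n) (Mem b) ≐ Mem (index (𝐬₂ a b))
s₁-graph {n} {a} {b} eq = to , from
  where
  to : App (Mem n) (Mem b) ⊆ Mem (index (𝐬₂ a b))
  to (app p q) with Mem⇒Arrow eq p
  to (app p (q ∷ [])) | s₁-at with refl ← at-atom q = atom
  to (app p q) | s₁-ar r = Arrow⇒Mem (kind-index (𝐬₂ a b))
    (s₂-ar (App-mono (λ i → i) (App-mono (fin⊆ q) (λ i → i)) r))
  from : Mem (index (𝐬₂ a b)) ⊆ App (Mem n) (Mem b)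
  from atom = app (Arrow⇒Mem eq s₁-at) (atom ∷ [])
  from p@(arrow _) with s₂-ar q ← Mem⇒Arrow (kind-index (𝐬₂ a b)) p
    with _ , r , s ← App-finiteᵐ q = app (Arrow⇒Mem eq (s₁-ar s)) r

s-graph : ∀ {n a} → kind n ≡ just 𝐬 → App (Mem n) (Mem a) ≐ Mem (index (𝐬₁ a))
s-graph {n} {a} eq = to , from
  where
  to : App (Mem n) (Mem a) ⊆ Mem (index (𝐬₁ a))
  to (app p q) with Mem⇒Arrow eq p
  to (app p (q ∷ [])) | s-at with refl ← at-atom q = atom
  to (app p (q ∷ [])) | s-at₁ with refl ← at-atom q = Arrow⇒Mem (kind-index (𝐬₁ a)) s₁-at
  to (app p q) | s-arr r = Arrow⇒Mem (kind-index (𝐬₁ a))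
    (s₁-ar (App-mono (App-mono (fin⊆ q) (λ i → i)) (λ i → i) r))
  from : Mem (index (𝐬₁ a)) ⊆ App (Mem n) (Mem a)
  from atom = app (Arrow⇒Mem eq s-at) (atom ∷ [])
  from p@(arrow _) with Mem⇒Arrow (kind-index (𝐬₁ a)) p
  ... | s₁-at = app (Arrow⇒Mem eq s-at₁) (atom ∷ [])
  ... | s₁-ar q with _ , r , s ← App-finiteˡ q = app (Arrow⇒Mem eq (s-arr s)) r

s-law : ∀ {n X Y Z} → kind n ≡ just 𝐬 →
        App (App (App (Mem n) X) Y) Z ≐ App (App X Z) (App Y Z)
s-law {n} {X} {Y} {Z} eq = to , from
  where
  to : App (App (App (Mem n) X) Y) Z ⊆ App (App X Z) (App Y Z)
  to (app (app (app p q) r) s) with s-arr t ← Mem⇒Arrow eq p =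
    App-mono (App-mono (fin⊆ q) (fin⊆ s)) (App-mono (fin⊆ r) (fin⊆ s)) t
  from : App (App X Z) (App Y Z) ⊆ App (App (App (Mem n) X) Y) Z
  -- Z, X and Y are cut down to finite parts in turn; what remains is the premise of `s-arr`.
  from p
    with _ , s , p₁ ← App-finiteʳ p
    with _ , q , p₂ ← App-finiteˡ p₁
    with _ , r , p₃ ← App-finiteᵐ p₂ = app (app (app (Arrow⇒Mem eq (s-arr p₃)) q) r) s

-- Denotations respect the application of K₁

value-of : ∀ d n {m c i c′} → Within d (decode n) ∅ m c → n ≡ i → φ i m c′ → Mem c′ ≐ Mem c
value-of d n {m} {c} {c′ = c′} h refl h′
  with refl ← Within-functional d (decode n) ∅ m {c′} {c} h′ h = ≐-refl

Law : ℕ → ℕ → Set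
Law d n = ∀ {m c} → Within d (decode n) ∅ m c → App (Mem n) (Mem m) ≐ Mem c

-- Only the case `𝐬₂` uses the induction hypotheses. The intermediate result p may exceed n, which
-- is why the bound d comes first in the order.
law-step : ∀ d n → (∀ {i} → i < n → Law d i) → (∀ {t} → t < d → ∀ i → Law t i) → Law d n
law-step d n ihₙ ih_d {m} {c} h = byKind (kind n) refl
  where
  at-index : ∀ {κ} → kind n ≡ just κ → ∀ {i} → i < index κ → i < n
  at-index eq {i} = subst (i <_) (sym (index-kind n eq))

  byKind : ∀ κ → kind n ≡ κ → App (Mem n) (Mem m) ≐ Mem c
  byKind nothing       eq = graph-law eq (Within-⟦⟧ {d} (decode n) {∅} {m} {c} h)
  byKind (just 𝐤)      eq = ≐-trans (k-graph eq) (value-of d n h (index-kind n eq) (φ-k m))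
  byKind (just 𝐬)      eq = ≐-trans (s-graph eq) (value-of d n h (index-kind n eq) (φ-s m))
  byKind (just (𝐤₁ a)) eq = ≐-trans (k₁-law eq) (value-of d n h (index-kind n eq) (φ-k₁ a m))
  byKind (just (𝐬₁ a)) eq = ≐-trans (s₁-graph eq) (value-of d n h (index-kind n eq) (φ-s₁ a m))
  byKind (just (𝐬₂ a b)) eq =
    let p , q , h₁ , h₂ , t , t<d , h₃ =
          φ-s₂⁻¹ d a b m c (subst (λ n → Within d (decode n) ∅ m c) (index-kind n eq) h)
    in ≐-trans (s₂-law eq)
         (≐-trans (App-cong (ihₙ (at-index eq (proj₁ (args<𝐬₂ a b))) {m} {p} h₁)
                            (ihₙ (at-index eq (proj₂ (args<𝐬₂ a b))) {m} {q} h₂))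
                  (ih_d t<d p {q} {c} (run-Within t p q h₃)))

-- Recursion on the bound d for simulated runs and on the index n for the
-- components of an s₂-term.
Within-law : ∀ {d} → Acc _<_ d → ∀ {n} → Acc _<_ n → Law d n
Within-law {d} (acc rd) {n} (acc rn) = law-step d n
  (λ i<n → Within-law (acc rd) (rn i<n))
  (λ t<d i → Within-law (rd t<d) (<-wellFounded i))

φ-law : ∀ {n m c} → φ n m c → App (Mem n) (Mem m) ≐ Mem c
φ-law {n} {m} {c} h with t , r ← φ-run {n} {m} {c} h =
  Within-law (<-wellFounded t) (<-wellFounded n) {m} {c} (run-Within t n m r)

-- Equational theories of total extensions of K₁

-- Numbers as applicative terms over the elements of K₁.
tcon : ℕ → ℕ
tcon a = pair 0 a

infixl 7 _·_
_·_ : ℕ → ℕ → ℕ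
n · m = pair (suc n) m

-- `reflexive` and `euclidean` together give an equivalence relation. In `distinct` the second
-- number is written `b + suc a`, so that the axiom has no hypothesis.
record Theory (Y : Pred ℕ 0ℓ) : Set where
  field
    reflexive : ∀ a → pair a a ∈ Y
    euclidean : ∀ a b c → pair a b ∈ Y → pair a c ∈ Y → pair b c ∈ Y
    congruent : ∀ a b c d → pair a b ∈ Y → pair c d ∈ Y → pair (a · c) (b · d) ∈ Y
    k-rule    : ∀ a b → pair (tcon k₀ · a · b) a ∈ Y
    s-rule    : ∀ a b c → pair (tcon s₀ · a · b · c) (a · c · (b · c)) ∈ Y
    φ-rule    : ∀ a b c → φ a b c → pair (tcon a · tcon b) (tcon c) ∈ Y
    distinct  : ∀ a b → pair (tcon a) (tcon (b + suc a)) ∉ Y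

infixl 7 _·ᵗ_
_·ᵗ_ : ∀ {n} → Tm n → Tm n → Tm n
t ·ᵗ u = sucᵗ t ,ᵗ u

tconᵗ : ∀ {n} → Tm n → Tm n
tconᵗ t = lit 0 ,ᵗ t

hornᵗ : ∀ {n} → Tm n → Tm n → Tm n → Tm n
hornᵗ p q r = ifz (ask p) (lit 1) (ifz (ask q) (lit 1) (ask r))

-- Zero iff the instance with parameters v1, …, v4 of the v0-th axiom of Theory
-- fails.  In the φ-rule the third parameter is a number of steps.
testᵗ : Tm 5
testᵗ = switch v0
  ( ask (a ,ᵗ a)
  ∷ hornᵗ (a ,ᵗ b) (a ,ᵗ c) (b ,ᵗ c)
  ∷ hornᵗ (a ,ᵗ b) (c ,ᵗ d) (a ·ᵗ c ,ᵗ b ·ᵗ d)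
  ∷ ask (tconᵗ (lit k₀) ·ᵗ a ·ᵗ b ,ᵗ a)
  ∷ ask (tconᵗ (lit s₀) ·ᵗ a ·ᵗ b ·ᵗ c ,ᵗ a ·ᵗ c ·ᵗ (b ·ᵗ c))
  ∷ ifz (call flagᵗ (σ ∷ᵛ []ᵛ)) (ask (tconᵗ a ·ᵗ tconᵗ b ,ᵗ tconᵗ (call outputᵗ (σ ∷ᵛ []ᵛ)))) (lit 1)
  ∷ [])
  (ifz (ask (tconᵗ a ,ᵗ tconᵗ (rec b (sucᵗ a) (sucᵗ v1)))) (lit 1) (lit 0))
  where
  a = v1
  b = v2
  c = v3
  d = v4
  σ = call run∅ᵗ (c ∷ᵛ a ∷ᵛ b ∷ᵛ []ᵛ)

test : (ℕ → ℕ) → (t a b c d : ℕ) → ℕ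
test χ t a b c d = num (eval χ testᵗ (leaf t ∷ᵛ leaf a ∷ᵛ leaf b ∷ᵛ leaf c ∷ᵛ leaf d ∷ᵛ []ᵛ))

test-horn : ∀ p q r {n} → n ≡ num (natrec (leaf 1) (λ _ _ → natrec (leaf 1) (λ _ _ → leaf r) q) p) →
            (n ≢ 0 → p ≢ 0 → q ≢ 0 → r ≢ 0) × ((p ≢ 0 → q ≢ 0 → r ≢ 0) → n ≢ 0)
test-horn zero    q       r refl = (λ _ p → ⊥-elim (p refl)) , λ _ ()
test-horn (suc p) zero    r refl = (λ _ _ q → ⊥-elim (q refl)) , λ _ ()
test-horn (suc p) (suc q) r refl = (λ h _ _ → h) , λ h → h 1+n≢0 1+n≢0

module _ (χ : ℕ → ℕ) where
  test-φ : ∀ a b c d → let S = run∅ c (init a b) in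
           test χ 5 a b c d ≡ if0 (flag S) (χ (pair (tcon a · tcon b) (tcon (output S)))) 1
  test-φ a b c d = trans
    (cong (λ s → value (eval χ flagᵗ (s ∷ᵛ []ᵛ)) (eval χ outputᵗ (s ∷ᵛ []ᵛ))) (eval-run∅ {χ} c a b))
    (trans (cong₂ value (eval-flag {χ} S) (eval-output {χ} S))
           (cong num (eval-if0 (flag S) _ 1)))
    where
    S = run∅ c (init a b)
    value : Val → Val → ℕ
    value f o = num (natrec (leaf (χ (pair (tcon a · tcon b) (pair 0 (num o))))) (λ _ _ → leaf 1) (num f))

  test-distinct : ∀ t a b c d → test χ (6 + t) a b c d ≡ if0 (χ (pair (tcon a) (tcon (b + suc a)))) 1 0
  test-distinct t a b c d = trans
    (cong (λ n → num (natrec (leaf 1) (λ _ _ → leaf 0) (χ (pair (tcon a) (tcon n))))) (sum b))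
    (cong num (eval-if0 (χ (pair (tcon a) (tcon (b + suc a)))) 1 0))
    where
    sum : ∀ b → num (natrec (leaf (suc a)) (λ _ r → leaf (suc (num r))) b) ≡ b + suc a
    sum zero    = refl
    sum (suc b) = cong suc (sum b)

module _ {Y : Pred ℕ 0ℓ} {χ : ℕ → ℕ} (Yχ : Char Y χ) where
  χ⇒∈ : ∀ {i} → χ i ≢ 0 → i ∈ Y
  χ⇒∈ {i} h with Yχ i
  ... | inj₁ (p , _) = p
  ... | inj₂ (_ , e) = ⊥-elim (h e)

  ∈⇒χ : ∀ {i} → i ∈ Y → χ i ≢ 0
  ∈⇒χ {i} p with Yχ i
  ... | inj₁ (_ , e)  = λ e′ → 1+n≢0 (trans (sym e) e′)
  ... | inj₂ (¬p , _) = ⊥-elim (¬p p)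

  Theory⇒test : Theory Y → ∀ t a b c d → test χ t a b c d ≢ 0
  Theory⇒test T 0 a b c d = ∈⇒χ (Theory.reflexive T a)
  Theory⇒test T 1 a b c d = proj₂ (test-horn (χ (pair a b)) (χ (pair a c)) (χ (pair b c)) refl)
    λ p q → ∈⇒χ (Theory.euclidean T a b c (χ⇒∈ p) (χ⇒∈ q))
  Theory⇒test T 2 a b c d = proj₂ (test-horn (χ (pair a b)) (χ (pair c d)) (χ (pair (a · c) (b · d))) refl)
    λ p q → ∈⇒χ (Theory.congruent T a b c d (χ⇒∈ p) (χ⇒∈ q))
  Theory⇒test T 3 a b c d = ∈⇒χ (Theory.k-rule T a b)
  Theory⇒test T 4 a b c d = ∈⇒χ (Theory.s-rule T a b c)
  Theory⇒test T 5 a b c d h with trans (sym (test-φ χ a b c d)) h | flag-0 (run∅ c (init a b))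
  ... | e | halt with flag (run∅ c (init a b))
  ...   | zero  = ∈⇒χ (Theory.φ-rule T a b (output (run∅ c (init a b))) (run-φ c a b (halt refl))) e
  ...   | suc _ with () ← e
  Theory⇒test T (suc (suc (suc (suc (suc (suc t)))))) a b c d h
    with χ (pair (tcon a) (tcon (b + suc a))) in eq | trans (sym (test-distinct χ t a b c d)) h
  ... | suc _ | _ = Theory.distinct T a b (χ⇒∈ λ e → 1+n≢0 (trans (sym eq) e))

  test⇒Theory : (∀ t a b c d → test χ t a b c d ≢ 0) → Theory Y
  test⇒Theory h = record
    { reflexive = λ a → χ⇒∈ (h 0 a 0 0 0)
    ; euclidean = λ a b c p q → χ⇒∈
                    (proj₁ (test-horn (χ (pair a b)) (χ (pair a c)) (χ (pair b c)) refl)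
                    (h 1 a b c 0) (∈⇒χ p) (∈⇒χ q))
    ; congruent = λ a b c d p q → χ⇒∈
                    (proj₁ (test-horn (χ (pair a b)) (χ (pair c d)) (χ (pair (a · c) (b · d))) refl)
                    (h 2 a b c d) (∈⇒χ p) (∈⇒χ q))
    ; k-rule    = λ a b → χ⇒∈ (h 3 a b 0 0)
    ; s-rule    = λ a b c → χ⇒∈ (h 4 a b c 0)
    ; φ-rule    = φ-rule
    ; distinct  = λ a b p → h 6 a b 0 0 (trans (test-distinct χ 0 a b 0 0) (refuted-by (∈⇒χ p)))
    }
    where
    refuted-by : ∀ {n} → n ≢ 0 → if0 n 1 0 ≡ 0
    refuted-by {zero}  p = ⊥-elim (p refl)
    refuted-by {suc n} p = refl
    φ-rule : ∀ a b c → φ a b c → pair (tcon a · tcon b) (tcon c) ∈ Y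
    φ-rule a b c p with t , halt ← φ-run {a} {b} {c} p = χ⇒∈ λ e →
      h 5 a b t 0 (trans (test-φ χ a b t 0)
        (trans (cong (λ S → if0 (flag S) (χ (pair (tcon a · tcon b) (tcon (output S)))) 1) halt) e))

violationᵗ : Tm 2
violationᵗ = call testᵗ
  (fstᵗ v1 ∷ᵛ fstᵗ (sndᵗ v1) ∷ᵛ fstᵗ (sndᵗ (sndᵗ v1)) ∷ᵛ
   fstᵗ (sndᵗ (sndᵗ (sndᵗ v1))) ∷ᵛ sndᵗ (sndᵗ (sndᵗ (sndᵗ v1))) ∷ᵛ []ᵛ)

decodedTest : (ℕ → ℕ) → ℕ → ℕ
decodedTest χ u =
  test χ (π₁ u) (π₁ (π₂ u)) (π₁ (π₂ (π₂ u))) (π₁ (π₂ (π₂ (π₂ u)))) (π₂ (π₂ (π₂ (π₂ u))))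

decodedTest-pair : ∀ χ t a b c d → decodedTest χ (pair t (pair a (pair b (pair c d)))) ≡ test χ t a b c d
decodedTest-pair χ t a b c d = begin
  decodedTest χ (pair t (pair a (pair b (pair c d)))) ≡⟨ cong₂ test₁ (π₁-pair t _) (π₂-pair t _) ⟩
  test₁ t (pair a (pair b (pair c d)))                ≡⟨ cong₂ test₂ (π₁-pair a _) (π₂-pair a _) ⟩
  test₂ a (pair b (pair c d))                         ≡⟨ cong₂ test₃ (π₁-pair b _) (π₂-pair b _) ⟩
  test₃ b (pair c d)                                  ≡⟨ cong₂ (test χ t a b) (π₁-pair c d) (π₂-pair c d) ⟩
  test χ t a b c d                                    ∎
  where
  open ≡-Reasoning
  test₁ test₂ test₃ : ℕ → ℕ → ℕ
  test₁ t u = test χ t (π₁ u) (π₁ (π₂ u)) (π₁ (π₂ (π₂ u))) (π₂ (π₂ (π₂ u)))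
  test₂ a u = test χ t a (π₁ u) (π₁ (π₂ u)) (π₂ (π₂ u))
  test₃ b u = test χ t a b (π₁ u) (π₂ u)

opaque
  -- The input is ignored, so with oracle `Y` this program halts on its own number iff some axiom
  -- instance fails for `Y`.
  violator : Code
  violator = Mu (code₂ violationᵗ)

  violator-sound : ∀ Y χ x y → Char Y χ → ⟦ violator ⟧ Y x y → ∃[ u ] decodedTest χ u ≡ 0
  violator-sound Y χ x y Yχ p =
    y , Mu-result Y (code₂ violationᵗ) x (decodedTest χ) (code₂-correct {Y} {χ} Yχ violationᵗ x) p

  violator-complete : ∀ Y χ x u → Char Y χ → decodedTest χ u ≡ 0 → ∃[ y ] ⟦ violator ⟧ Y x y
  violator-complete Y χ x u Yχ =
    Mu-search Y (code₂ violationᵗ) x (decodedTest χ) (code₂-correct {Y} {χ} Yχ violationᵗ x) u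

violator∈′ : ∀ Y → (⌜ violator ⌝ ∈ Y ′ → ∃[ y ] ⟦ violator ⟧ Y ⌜ violator ⌝ y)
                 × ((∃[ y ] ⟦ violator ⟧ Y ⌜ violator ⌝ y) → ⌜ violator ⌝ ∈ Y ′)
violator∈′ Y =
  (λ (y , p) → y , subst (λ c → ⟦ c ⟧ Y ⌜ violator ⌝ y) (decode-⌜⌝ violator) p) ,
  (λ (y , p) → y , ⟦⟧⇒Φ Y violator ⌜ violator ⌝ y p)

module _ {Y : Pred ℕ 0ℓ} {χ : ℕ → ℕ} (Yχ : Char Y χ) where
  Theory⇒∉′ : Theory Y → ⌜ violator ⌝ ∉ Y ′
  Theory⇒∉′ T h with y , p ← proj₁ (violator∈′ Y) h
                with u , e ← violator-sound Y χ ⌜ violator ⌝ y Yχ p =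
    Theory⇒test {Y} {χ} Yχ T (π₁ u) (π₁ (π₂ u)) (π₁ (π₂ (π₂ u))) (π₁ (π₂ (π₂ (π₂ u))))
                (π₂ (π₂ (π₂ (π₂ u)))) e

  ∉′⇒Theory : ⌜ violator ⌝ ∉ Y ′ → Theory Y
  ∉′⇒Theory h = test⇒Theory {Y} {χ} Yχ λ t a b c d e →
    h (proj₂ (violator∈′ Y) (violator-complete Y χ ⌜ violator ⌝ (pair t (pair a (pair b (pair c d)))) Yχ
        (trans (decodedTest-pair χ t a b c d) e)))

-- The theory of the graph model

-- An inductive family with equations for t, since the terms are numbers and offer no structural
-- recursion.
data Term⟦_⟧ (t : ℕ) : Sub where
  in-con : ∀ {a x} → t ≡ tcon a → Mem a x → Term⟦ t ⟧ x
  in-app : ∀ {n m F x} → t ≡ n · m → Term⟦ n ⟧ (F ⇒ x) → All Term⟦ m ⟧ F → Term⟦ t ⟧ x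

Term-con : ∀ a → Term⟦ tcon a ⟧ ≐ Mem a
Term-con a = to , in-con refl
  where
  to : Term⟦ tcon a ⟧ ⊆ Mem a
  to (in-con e p)   with refl ← proj₂ (pair-injective e) = p
  to (in-app e _ _) with () ← proj₁ (pair-injective e)

Term-app : ∀ n m → Term⟦ n · m ⟧ ≐ App Term⟦ n ⟧ Term⟦ m ⟧
Term-app n m = to , λ { (app p q) → in-app refl p q }
  where
  to : Term⟦ n · m ⟧ ⊆ App Term⟦ n ⟧ Term⟦ m ⟧
  to (in-con e p)   with () ← proj₁ (pair-injective e)
  to (in-app e p q) with pair-injective e
  ... | refl , refl = app p q

GraphTheory : Pred ℕ 0ℓ
GraphTheory p = Term⟦ π₁ p ⟧ ≐ Term⟦ π₂ p ⟧

private
  Equal : ℕ → ℕ → Set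
  Equal a b = Term⟦ a ⟧ ≐ Term⟦ b ⟧

  to-Graph : ∀ {a b} → Equal a b → pair a b ∈ GraphTheory
  to-Graph {a} {b} = subst₂ Equal (sym (π₁-pair a b)) (sym (π₂-pair a b))

  from-Graph : ∀ {a b} → pair a b ∈ GraphTheory → Equal a b
  from-Graph {a} {b} = subst₂ Equal (π₁-pair a b) (π₂-pair a b)

  app₂ : ∀ a b c → Term⟦ a · b · c ⟧ ≐ App (App Term⟦ a ⟧ Term⟦ b ⟧) Term⟦ c ⟧
  app₂ a b c = ≐-trans (Term-app (a · b) c) (App-cong (Term-app a b) ≐-refl)

GraphTheory-Theory : Theory GraphTheory
GraphTheory-Theory = record
  { reflexive = λ a → to-Graph ≐-refl
  ; euclidean = λ a b c p q → to-Graph (≐-trans (≐-sym (from-Graph p)) (from-Graph q))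
  ; congruent = λ a b c d p q → to-Graph
      (≐-trans (Term-app a c) (≐-trans (App-cong (from-Graph p) (from-Graph q)) (≐-sym (Term-app b d))))
  ; k-rule    = λ a b → to-Graph
      (≐-trans (app₂ (tcon k₀) a b)
      (≐-trans (App-cong (App-cong (Term-con k₀) ≐-refl) ≐-refl) (k-law (kind-index 𝐤))))
  ; s-rule    = λ a b c → to-Graph
      (≐-trans (≐-trans (Term-app (tcon s₀ · a · b) c) (App-cong (app₂ (tcon s₀) a b) ≐-refl))
      (≐-trans (App-cong (App-cong (App-cong (Term-con s₀) ≐-refl) ≐-refl) ≐-refl)
      (≐-trans (s-law (kind-index 𝐬))
      (≐-sym (≐-trans (Term-app (a · c) (b · c)) (App-cong (Term-app a c) (Term-app b c)))))))
  ; φ-rule    = λ a b c p → to-Graph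
      (≐-trans (Term-app (tcon a) (tcon b))
      (≐-trans (App-cong (Term-con a) (Term-con b))
      (≐-trans (φ-law {a} {b} {c} p) (≐-sym (Term-con c)))))
  -- The atom at a separates the two denotations.
  ; distinct  = λ a b p → m≢1+n+m a (trans
      (at-atom (proj₁ (≐-trans (≐-sym (Term-con a)) (≐-trans (from-Graph p) (Term-con (b + suc a)))) atom))
      (+-suc b a))
  }

-- The term model of a theory

module Quotient (em : ExcludedMiddle 0ℓ) (Y : Pred ℕ 0ℓ) (T : Theory Y) where
  open Theory T

  infix 4 _~_
  _~_ : ℕ → ℕ → Set
  a ~ b = pair a b ∈ Y

  ~-sym : ∀ {a b} → a ~ b → b ~ a
  ~-sym {a} {b} p = euclidean a b a p (reflexive a)

  ~-trans : ∀ {a b c} → a ~ b → b ~ c → a ~ c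
  ~-trans {a} {b} {c} p q = euclidean b a c (~-sym p) q

  Least : ℕ → ℕ → Set
  Least a b = a ~ b × (∀ j → j < b → ¬ (a ~ j))

  least : ∀ a → ∃[ b ] Least a b
  least a = <-rec (λ i → a ~ i → ∃[ b ] Least a b) search a (reflexive a)
    where
    search : ∀ i → (∀ {j} → j < i → a ~ j → ∃[ b ] Least a b) → a ~ i → ∃[ b ] Least a b
    search i ih p with em {∃[ j ] (j < i × a ~ j)}
    ... | yes (j , j<i , q) = ih j<i q
    ... | no ¬q             = i , p , λ j j<i q → ¬q (j , j<i , q)

  canon : ℕ → ℕ
  canon a = proj₁ (least a)

  canon-~ : ∀ a → a ~ canon a
  canon-~ a = proj₁ (proj₂ (least a))

  canon-cong : ∀ {a b} → a ~ b → canon a ≡ canon b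
  canon-cong {a} {b} p with <-cmp (canon a) (canon b)
  ... | tri≈ _ e _ = e
  ... | tri< l _ _ = ⊥-elim (proj₂ (proj₂ (least b)) _ l (~-trans (~-sym p) (canon-~ a)))
  ... | tri> _ _ g = ⊥-elim (proj₂ (proj₂ (least a)) _ g (~-trans p (canon-~ b)))

  -- Canonical representatives, since there are no quotient types.
  Element : Set
  Element = Σ[ n ∈ ℕ ] canon n ≡ n

  γ : ℕ → Element
  γ n = canon n , sym (canon-cong (canon-~ n))

  element-≡ : ∀ {a b : Element} → proj₁ a ≡ proj₁ b → a ≡ b
  element-≡ {_ , p} {_ , q} refl = cong (_ ,_) (≡-irrelevant p q)

  γ-cong : ∀ {n m} → n ~ m → γ n ≡ γ m
  γ-cong p = element-≡ (canon-cong p)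

  γ-injective : ∀ {n m} → γ n ≡ γ m → n ~ m
  γ-injective {n} {m} e =
    ~-trans (canon-~ n) (subst (_~ m) (sym (cong proj₁ e)) (~-sym (canon-~ m)))

  γ-proj₁ : ∀ a → γ (proj₁ a) ≡ a
  γ-proj₁ (n , p) = element-≡ p

  𝒜 : PAS
  𝒜 = record
    { Carrier    = Element
    ; _·_↦_      = λ a b c → γ (proj₁ a · proj₁ b) ≡ c
    ; functional = λ p q → trans (sym p) q
    }

  open PAS 𝒜 using (_·_↦_; _⇓_; con; _∙_; IsCombinators)

  γ-app : ∀ n m → γ n · γ m ↦ γ (n · m)
  γ-app n m = γ-cong (congruent _ _ _ _ (~-sym (canon-~ n)) (~-sym (canon-~ m)))

  ⇓-con : ∀ a → con a ⇓ γ (proj₁ a)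
  ⇓-con a = sym (γ-proj₁ a)

  ⇓-app : ∀ {t u n m} → t ⇓ γ n → u ⇓ γ m → t ∙ u ⇓ γ (n · m)
  ⇓-app {n = n} {m} p q = γ n , γ m , p , q , γ-app n m

  ι : ℕ → Element
  ι a = γ (tcon a)

  combinators : IsCombinators (ι k₀) (ι s₀)
  combinators = record
    { ka↓  = λ a → _ , ⇓-app {con (ι k₀)} {con a} refl (⇓-con a)
    ; kab  = λ a b → subst (con (ι k₀) ∙ con a ∙ con b ⇓_)
        (trans (γ-cong (k-rule (proj₁ a) (proj₁ b))) (γ-proj₁ a))
        (⇓-app {con (ι k₀) ∙ con a} {con b} (⇓-app {con (ι k₀)} {con a} refl (⇓-con a)) (⇓-con b))
    ; sab↓ = λ a b → _ , sab a b
    ; sabc = λ a b c → inj₂ (_ ,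
        subst (con (ι s₀) ∙ con a ∙ con b ∙ con c ⇓_)
          (γ-cong (s-rule (proj₁ a) (proj₁ b) (proj₁ c)))
          (⇓-app {con (ι s₀) ∙ con a ∙ con b} {con c} (sab a b) (⇓-con c)) ,
        ⇓-app {con a ∙ con c} {con b ∙ con c}
          (⇓-app {con a} {con c} (⇓-con a) (⇓-con c)) (⇓-app {con b} {con c} (⇓-con b) (⇓-con c)))
    }
    where
    sab : ∀ a b → con (ι s₀) ∙ con a ∙ con b ⇓ γ (tcon s₀ · proj₁ a · proj₁ b)
    sab a b = ⇓-app {con (ι s₀) ∙ con a} {con b} (⇓-app {con (ι s₀)} {con a} refl (⇓-con a)) (⇓-con b)

  ι-< : ∀ {a b} → a < b → ι a ≢ ι b
  ι-< {a} {b} a<b e = distinct a (b ∸ suc a)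
    (subst (λ b → tcon a ~ tcon b) (sym (m∸n+n≡m a<b)) (γ-injective e))

  ι-injective : ∀ {a b} → ι a ≡ ι b → a ≡ b
  ι-injective {a} {b} e with <-cmp a b
  ... | tri< l _ _ = ⊥-elim (ι-< l e)
  ... | tri≈ _ p _ = p
  ... | tri> _ _ g = ⊥-elim (ι-< g (sym e))

  completion : IsStrongCompletion K₁ 𝒜
  completion =
    (((ι 0 , ι 1 , λ e → 0≢1+n (ι-injective e)) , ι k₀ , ι s₀ , combinators) , λ a b → _ , refl) ,
    record
      { weakEmbedding   = record
        { f         = ι
        ; injective = ι-injective
        ; preserves = λ {a} {b} {c} p → trans (γ-app (tcon a) (tcon b)) (γ-cong (φ-rule a b c p))
        }
      ; k               = k₀
      ; s               = s₀
      ; ks-combinators  = K₁-combinators em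
      ; fks-combinators = combinators
      }

  computable : (Y -Computable) 𝒜
  computable = record
    { γ            = γ
    ; γ-surjective = λ a → proj₁ a , γ-proj₁ a
    ; ψ            = _·_
    ; ψ-computable = ⌜ application ⌝ , λ n m → ⟦⟧⇒Φ Y application ⟨ n , m ⟩ (n · m)
        (Pair-correct Y (Comp Succ Fst) Snd ⟨ n , m ⟩
          (n , sym (π₁-⟨⟩ n m) , refl) (sym (π₂-⟨⟩ n m)))
    ; γ-ψ          = γ-app
    -- `Y` is the set of pairs of equal terms, so a single oracle query decides equality.
    ; ≡-computable = ⌜ Oracle ⌝ , λ p →
        (λ e → ⟦⟧⇒Φ Y Oracle p 1 (inj₁ (subst (_∈ Y) (pair-π p) (γ-injective e) , refl))) ,
        (λ e → ⟦⟧⇒Φ Y Oracle p 0 (inj₂ ((λ i → e (γ-cong (subst (_∈ Y) (sym (pair-π p)) i))) , refl)))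
    }
    where
    application : Code
    application = Pair (Comp Succ Fst) Snd

theorem5p3 : ExcludedMiddle 0ℓ →
    Σ[ Y ∈ Pred ℕ 0ℓ ] (Low Y × (Σ[ 𝒜 ∈ PAS ] (IsStrongCompletion K₁ 𝒜 × (Y -Computable) 𝒜)))
theorem5p3 em = Y , proj₁ (proj₂ low-Y) , 𝒜 , completion , computable
  where
  low-Y : Σ[ Y ∈ Pred ℕ 0ℓ ] (Low Y × ⌜ violator ⌝ ∉ Y ′)
  low-Y = low-basis em ⌜ violator ⌝ (GraphTheory ,
    Theory⇒∉′ (proj₂ (characteristic em GraphTheory)) GraphTheory-Theory)
  Y : Pred ℕ 0ℓ
  Y = proj₁ low-Y
  open Quotient em Y (∉′⇒Theory (proj₂ (characteristic em Y)) (proj₂ (proj₂ low-Y)))
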